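{- Let $N$ be an odd perfect number (i.e. $N$ is odd and $\sigma(N)=2N$), and write $\omega=\omega(N)$ for the number of distinct prime factors of $N$ and $\Omega=\Omega(N)$ for the number of prime factors of $N$ counted with multiplicity. If $3\nmid N$, then $$\frac{302}{113}\omega-\frac{286}{113}\le \Omega.$$ If $3\mid N$, then $$\frac{66}{25}\omega-5\le \Omega.$$
   Context: $\sigma(n)$ denotes the sum of the positive divisors of $n$. -}

module Defs where

open import Data.Nat using (ℕ; zero; suc; _+_; _*_; _^_)
open import Data.Nat.Divisibility using (_∣_; _∣?_)
open import Data.Nat.Primality using (Prime; prime?)
open import Data.List using (List; filter; length; map; upTo)
open import Data.Nat.ListAction using (sum)
open import Relation.Nullary using (¬_)

range1 : ℕ → List ℕ
range1 n = map suc (upTo n)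

divisors : ℕ → List ℕ
divisors n = filter (λ d → d ∣? n) (range1 n)

σ : ℕ → ℕ
σ n = sum (divisors n)

primeDivisors : ℕ → List ℕ
primeDivisors n = filter prime? (divisors n)

ω : ℕ → ℕ
ω n = length (primeDivisors n)

-- p-adic valuation of n ≥ 1 for p ≥ 2: number of k ∈ [1, n] with p^k ∣ n
-- (since p^k > n ≥ 1 for k > n, this is the full exponent of p in n)
valuation : ℕ → ℕ → ℕ
valuation p n = length (filter (λ k → (p ^ k) ∣? n) (range1 n))

Ω : ℕ → ℕ
Ω n = sum (map (λ p → valuation p n) (primeDivisors n))

Odd : ℕ → Set
Odd N = ¬ (2 ∣ N)

open import Relation.Binary.PropositionalEquality using (_≡_)
Perfect : ℕ → Set
Perfect N = σ N ≡ 2 * N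

{-# OPTIONS --safe #-}
-- Let S be the set of primes x with x² ∥ N and write Φ x = x² + x + 1 = σ(x²). The product of
-- the Φ x over S divides σ(N) = 2 N, so their prime factors occupy slots among the prime factors
-- of N, and S cannot be much larger than the rest of N unless many Φ x have few prime factors.
-- That is limited as follows. Prime factors of Φ x are 3 or ≡ 1 (mod 3), and 3 ∣ Φ x only
-- for x ≡ 1 (mod 3). A prime r > x divides Φ x for at most one x ≡ 2 (mod 3). If r = Φ a is prime
-- for some a ∈ S, any prime y > a in S with r ∣ Φ y satisfies y ≥ 2 r, so r is not the largest
-- prime factor of a Φ y with exactly two prime factors other than 3. Finally Φ y is never a
-- product of three primes Φ a, Φ b, Φ c with a, b, c, y ≡ 2 (mod 3): in the Eisenstein integers
-- such a factorisation forces (a - c)(b - c) = c (c + 1) up to order, whereas c is prime. The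
-- resulting constraints form a linear programme, which is bounded by a dual solution.
module Submission where

open import Defs
import Data.Nat as ℕ
open ℕ using (ℕ; zero; suc; s≤s; z≤n)
import Data.Nat.Properties as ℕ
import Data.Nat.Divisibility as ℕ
open import Data.Nat.Primality
open import Data.Empty using (⊥; ⊥-elim)
open import Data.Product using (_×_; _,_; proj₁; proj₂; ∃; map₂)
open import Data.Sum using (_⊎_; inj₁; inj₂)
open import Function using (_∘_; case_of_; mk⇔)
open import Relation.Nullary
open import Relation.Binary.PropositionalEquality

-- Write the claim as κ ω ≤ ρ Ω + const with 2 < κ/ρ < 3. At most one exponent of N is odd, so apart
-- from that prime only the exponent 2 lies below κ/ρ, and each x in S is short by κ - 2ρ. That is
-- the demand `dB` of an x ≡ 2 (mod 3): 76 = 302 - 2·113, and after doubling 32 = 132 - 2·50. Such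
-- an x divides no `Φ y` and pays nothing itself. An x ≡ 1 (mod 3) in S may also be a factor of
-- other `Φ y`, so its demand includes the most it can be asked to pay: `dA` = 73 = 32 + 2·9 + 23,
-- reached by kind U. If 3 does not divide N, then S contains no x ≡ 1, because 3 ∣ Φ x ∣ N; this
-- allows the better ratio and weights with `t`, `c` and `dA` zero.

Φ : ℕ → ℕ
Φ x = x ℕ.* x ℕ.+ x ℕ.+ 1

-- Norm equations in the Eisenstein integers

module Eisenstein where
  open import Data.Integer hiding (suc)
  open import Data.Integer.Properties
  open import Data.Integer.Divisibility.Signed using (_∣_; divides; ∣ᵤ⇒∣; ∣⇒∣ᵤ; ∣m⇒∣m*n; ∣m∣n⇒∣m+n; ∣m∣n⇒∣m-n)
  open import Data.Integer.Tactic.RingSolver using (solve-∀)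
  import Data.Nat.Tactic.RingSolver as ℕ-Ring

  -- (g , h) stands for g + h ω with ω² + ω + 1 = 0; times C and times′ C are the multiplications
  -- by 1 + C ω and by its conjugate 1 + C ω², both of norm C² - C + 1, which is Φ a for C = a + 1.
  norm : ℤ × ℤ → ℤ
  norm (g , h) = g * g - g * h + h * h

  conj : ℤ × ℤ → ℤ × ℤ
  conj (g , h) = g - h , - h

  times : ℤ → ℤ × ℤ → ℤ × ℤ
  times C (g , h) = g - C * h , h + C * g - C * h

  times′ : ℤ → ℤ × ℤ → ℤ × ℤ
  times′ C (g , h) = g - C * g + C * h , h - C * g

  -- Congruence to 1 modulo 3. Among the six units only 1 satisfies it, so factorisations carry no
  -- unit ambiguity.
  Primary : ℤ × ℤ → Set
  Primary (g , h) = (+ 3 ∣ g - + 1) × (+ 3 ∣ h)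

  -- The two factors are the ω-coordinates of g + h ω times the conjugate of 1 + C ω and times 1 + C
  -- ω itself. A prime norm dividing `norm (g , h)` must therefore divide one of them, which tells
  -- which of the two divides g + h ω.
  cross-factors : ∀ C g h → (h - g * C) * (h + g * C - h * C) ≡ (C * C - C + + 1) * (g * h - g * g) + (+ 1 - C) * (g * g - g * h + h * h)
  cross-factors = solve-∀

  quot-g : ∀ C g q → g ≡ g + C * q - C * q
  quot-g = solve-∀

  sub-add : ∀ C g h → h ≡ h - g * C + g * C
  sub-add = solve-∀

  quot-h-expand : ∀ C g q → q * (C * C - C + + 1) + g * C ≡ q + C * (g + C * q) - C * q
  quot-h-expand = solve-∀

  quot-h : ∀ C g h q → h - g * C ≡ q * (C * C - C + + 1) → h ≡ q + C * (g + C * q) - C * q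
  quot-h C g h q e = trans (sub-add C g h) (trans (cong (_+ g * C) e) (quot-h-expand C g q))

  norm-times : ∀ C g h → (g - C * h) * (g - C * h) - (g - C * h) * (h + C * g - C * h) + (h + C * g - C * h) * (h + C * g - C * h)
             ≡ (g * g - g * h + h * h) * (C * C - C + + 1)
  norm-times = solve-∀

  norm-conj : ∀ g h → (g - h) * (g - h) - (g - h) * (- h) + (- h) * (- h) ≡ g * g - g * h + h * h
  norm-conj = solve-∀

  conj-involutive : ∀ g h → g ≡ g - h - (- h)
  conj-involutive = solve-∀

  conj-factor : ∀ C g h → h + g * C - h * C ≡ - (- h - (g - h) * C)
  conj-factor = solve-∀

  conj-times-g : ∀ C g h → (g - C * h) - (h + C * g - C * h) ≡ (g - h) - C * (g - h) + C * (- h)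
  conj-times-g = solve-∀

  conj-times-h : ∀ C g h → - (h + C * g - C * h) ≡ (- h) - C * (g - h)
  conj-times-h = solve-∀

  conj-times : ∀ C g h → times′ C (conj (g , h)) ≡ conj (times C (g , h))
  conj-times C g h = cong₂ _,_ (sym (conj-times-g C g h)) (sym (conj-times-h C g h))

  conj-conj : ∀ g h → conj (conj (g , h)) ≡ (g , h)
  conj-conj g h = cong₂ _,_ (sym (conj-involutive g h)) (neg-involutive h)

  collect : ∀ r u C m → r * u + (+ 1 - C) * (m * r) ≡ (u + (+ 1 - C) * m) * r
  collect = solve-∀

  euclid-ℤ : ∀ {r} → Prime r → ∀ x y → (+ r) ∣ x * y → (+ r ∣ x) ⊎ (+ r ∣ y)
  euclid-ℤ {r} rp x y d with euclidsLemma ∣ x ∣ ∣ y ∣ rp (subst (r ℕ.∣_) (abs-* x y) (∣⇒∣ᵤ d))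
  ... | inj₁ p = inj₁ (∣ᵤ⇒∣ p)
  ... | inj₂ p = inj₂ (∣ᵤ⇒∣ p)

  ∣-neg : ∀ {d} x → d ∣ - x → d ∣ x
  ∣-neg x (divides q e) = divides (- q) (trans (sym (neg-involutive x)) (trans (cong -_ e) (neg-distribˡ-* q _)))

  module _ {r} (rp : Prime r) (C : ℤ) (er : + r ≡ C * C - C + + 1) where
    private instance
      r≢0 : NonZero (+ r)
      r≢0 = ≢-nonZero λ e → ℕ.≢-nonZero⁻¹ r ⦃ prime⇒nonZero rp ⦄ (+-injective e)

    -- Multiplying by the conjugate of 1 + C ω and dividing by r gives the quotient; once the
    -- ω-coordinate is q r, the real coordinate is (g + C q) r.
    divide-times : ∀ g h m → norm (g , h) ≡ m * + r → + r ∣ h - g * C → ∃ λ γ → norm γ ≡ m × times C γ ≡ (g , h)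
    divide-times g h m en (divides q e) = (g′ , q) , *-cancelʳ-≡ (norm (g′ , q)) m (+ r) norm≡ , cong₂ _,_ (sym eg) (sym eh)
      where
      g′ = g + C * q
      eg : g ≡ g′ - C * q
      eg = quot-g C g q
      eh : h ≡ q + C * g′ - C * q
      eh = quot-h C g h q (trans e (cong (q *_) er))
      norm≡ : norm (g′ , q) * + r ≡ m * + r
      norm≡ = trans (cong (norm (g′ , q) *_) er) (trans (sym (norm-times C g′ q))
                (trans (sym (cong₂ (λ g h → norm (g , h)) eg eh)) en))

    cross-factor-divisible : ∀ g h m → norm (g , h) ≡ m * + r →
             (h - g * C) * (h + g * C - h * C) ≡ (g * h - g * g + (+ 1 - C) * m) * + r
    cross-factor-divisible g h m en = begin
      (h - g * C) * (h + g * C - h * C)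
        ≡⟨ cross-factors C g h ⟩
      (C * C - C + + 1) * (g * h - g * g) + (+ 1 - C) * norm (g , h)
        ≡⟨ cong₂ (λ a b → a * (g * h - g * g) + (+ 1 - C) * b) (sym er) en ⟩
      + r * (g * h - g * g) + (+ 1 - C) * (m * + r)
        ≡⟨ collect (+ r) (g * h - g * g) C m ⟩
      (g * h - g * g + (+ 1 - C) * m) * + r ∎
      where open ≡-Reasoning

    Quotient : ℤ → ℤ → ℤ → Set
    Quotient g h m = ∃ λ γ → norm γ ≡ m × (times C γ ≡ (g , h) ⊎ times′ C γ ≡ (g , h))

    -- Replaces unique factorisation: a prime norm r can be split off as one of its two conjugate
    -- factors, with an explicit quotient.
    divide : ∀ g h m → norm (g , h) ≡ m * + r → Quotient g h m
    divide g h m en = cases (euclid-ℤ rp (h - g * C) (h + g * C - h * C)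
      (divides ((g * h - g * g) + (+ 1 - C) * m) (cross-factor-divisible g h m en)))
      where
      conjugate : (∃ λ γ → norm γ ≡ m × times C γ ≡ (g - h , - h)) → Quotient g h m
      conjugate ((g′ , h′) , n , t) = conj (g′ , h′) , trans (norm-conj g′ h′) n ,
        inj₂ (trans (conj-times C g′ h′) (trans (cong conj t) (conj-conj g h)))
      cases : (+ r ∣ h - g * C) ⊎ (+ r ∣ h + g * C - h * C) → Quotient g h m
      cases (inj₁ d) = map₂ (map₂ inj₁) (divide-times g h m en d)
      cases (inj₂ d) = conjugate (divide-times (g - h) (- h) m (trans (norm-conj g h) en)
        (∣-neg (- h - (g - h) * C) (subst (+ r ∣_) (conj-factor C g h) d)))

  times-g : ∀ C g h → g - C * h - + 1 + C * h ≡ g - + 1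
  times-g = solve-∀
  times-h : ∀ C g h → h + C * g - C * h - C * (g - h) ≡ h
  times-h = solve-∀
  times′-g : ∀ C g h → g - C * g + C * h - + 1 + C * (g - h) ≡ g - + 1
  times′-g = solve-∀
  times′-h : ∀ C g h → h - C * g + C * g ≡ h
  times′-h = solve-∀

  -- For 3 ∣ C the factor 1 + C ω is itself 1 modulo 3, so multiplying by it changes no residues.
  times-primary : ∀ C γ → + 3 ∣ C → Primary (times C γ) → Primary γ
  times-primary C (g , h) 3∣C (pg , ph) =
    subst (+ 3 ∣_) (times-g C g h) (∣m∣n⇒∣m+n pg (∣m⇒∣m*n h 3∣C)) ,
    subst (+ 3 ∣_) (times-h C g h) (∣m∣n⇒∣m-n ph (∣m⇒∣m*n (g - h) 3∣C))

  times′-primary : ∀ C γ → + 3 ∣ C → Primary (times′ C γ) → Primary γ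
  times′-primary C (g , h) 3∣C (pg , ph) =
    subst (+ 3 ∣_) (times′-g C g h) (∣m∣n⇒∣m+n pg (∣m⇒∣m*n (g - h) 3∣C)) ,
    subst (+ 3 ∣_) (times′-h C g h) (∣m∣n⇒∣m+n ph (∣m⇒∣m*n g 3∣C))

  square-abs : ∀ i → i * i ≡ + (∣ i ∣ ℕ.* ∣ i ∣)
  square-abs (+ n) = sym (pos-* n n)
  square-abs -[1+ n ] = refl

  4*norm : ∀ g q → (+ 2 * g - q * + 3) * (+ 2 * g - q * + 3) + + 27 * (q * q)
         ≡ + 4 * (g * g - g * (q * + 3) + (q * + 3) * (q * + 3))
  4*norm = solve-∀

  norm-real : ∀ g → g * g - g * + 0 + + 0 * + 0 ≡ g * g
  norm-real = solve-∀

  -- With h = 3 q, four times the norm is (2 g - 3 q)² + 27 q², and 27 > 4 forces q = 0; the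
  -- congruence then selects 1 from g = ±1.
  primary-unit : ∀ γ → Primary γ → norm γ ≡ + 1 → γ ≡ (+ 1 , + 0)
  primary-unit (g , h) (pg , divides q refl) e = real (∣i∣≡0⇒i≡0 (q≡0 (∣ s ∣ ℕ.* ∣ s ∣) ∣ q ∣ four))
    where
    s = + 2 * g - q * + 3
    open ≡-Reasoning
    four : ∣ s ∣ ℕ.* ∣ s ∣ ℕ.+ 27 ℕ.* (∣ q ∣ ℕ.* ∣ q ∣) ≡ 4
    four = +-injective (begin
      + (∣ s ∣ ℕ.* ∣ s ∣ ℕ.+ 27 ℕ.* (∣ q ∣ ℕ.* ∣ q ∣))
        ≡⟨ cong₂ _+_ (square-abs s) (trans (cong (+ 27 *_) (square-abs q)) (sym (pos-* 27 (∣ q ∣ ℕ.* ∣ q ∣)))) ⟨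
      s * s + + 27 * (q * q)
        ≡⟨ 4*norm g q ⟩
      + 4 * norm (g , q * + 3)
        ≡⟨ cong (+ 4 *_) e ⟩
      + 4 ∎)
    q≡0 : ∀ a n → a ℕ.+ 27 ℕ.* (n ℕ.* n) ≡ 4 → n ≡ 0
    q≡0 _ zero _ = refl
    q≡0 a (suc n) e = ⊥-elim (ℕ.<⇒≢ (ℕ.≤-trans (ℕ.m≤m+n 5 22) (ℕ.≤-trans (ℕ.*-monoʳ-≤ 27 {1} (s≤s z≤n)) (ℕ.m≤n+m _ a))) (sym e))
    real : q ≡ + 0 → (g , q * + 3) ≡ (+ 1 , + 0)
    real refl = one g pg (ℕ.m*n≡1⇒m≡1 ∣ g ∣ ∣ g ∣ (+-injective (trans (sym (square-abs g)) (trans (sym (norm-real g)) e))))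
      where
      one : ∀ g → + 3 ∣ g - + 1 → ∣ g ∣ ≡ 1 → (g , + 0) ≡ (+ 1 , + 0)
      one (+ 1) _ refl = refl
      one -[1+ 0 ] d refl with ℕ.∣⇒≤ (∣⇒∣ᵤ d)
      ... | s≤s (s≤s ())

  -- The real parts of the eight products of 1 + A ω, 1 + B ω, 1 + C ω or their conjugates (⁻),
  -- solved for the equation obtained when the real part is 1.
  real⁺⁺⁺ : ∀ A B C → A * B * C ≡ (A * B + B * C + C * A) + (
    (((+ 1 - C * + 0) - B * (+ 0 + C * + 1 - C * + 0)) - A * ((+ 0 + C * + 1 - C * + 0) + B * (+ 1 - C * + 0) - B * (+ 0 + C * + 1 - C * + 0))) - + 1)
  real⁺⁺⁺ = solve-∀

  real⁺⁺⁻ : ∀ A B C → (A + B) * C ≡ (A * B + C) + (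
    (((+ 1 - C * + 1 + C * + 0) - B * (+ 0 - C * + 1)) - A * ((+ 0 - C * + 1) + B * (+ 1 - C * + 1 + C * + 0) - B * (+ 0 - C * + 1))) - + 1)
  real⁺⁺⁻ = solve-∀

  real⁺⁻⁺ : ∀ A B C → (A + C) * B ≡ (A * C + B) + (
    (((+ 1 - C * + 0) - B * (+ 1 - C * + 0) + B * (+ 0 + C * + 1 - C * + 0)) - A * ((+ 0 + C * + 1 - C * + 0) - B * (+ 1 - C * + 0))) - + 1)
  real⁺⁻⁺ = solve-∀

  real⁺⁻⁻ : ∀ A B C → (B + C) * A ≡ (B + C + B * C * A) + (
    (((+ 1 - C * + 1 + C * + 0) - B * (+ 1 - C * + 1 + C * + 0) + B * (+ 0 - C * + 1)) - A * ((+ 0 - C * + 1) - B * (+ 1 - C * + 1 + C * + 0))) - + 1)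
  real⁺⁻⁻ = solve-∀

  real⁻⁺⁺ : ∀ A B C → (B + C) * A ≡ (B * C + A) + (
    (((+ 1 - C * + 0) - B * (+ 0 + C * + 1 - C * + 0)) - A * ((+ 1 - C * + 0) - B * (+ 0 + C * + 1 - C * + 0)) + A * ((+ 0 + C * + 1 - C * + 0) + B * (+ 1 - C * + 0) - B * (+ 0 + C * + 1 - C * + 0))) - + 1)
  real⁻⁺⁺ = solve-∀

  real⁻⁺⁻ : ∀ A B C → (A + C) * B ≡ (A + C + A * C * B) + (
    (((+ 1 - C * + 1 + C * + 0) - B * (+ 0 - C * + 1)) - A * ((+ 1 - C * + 1 + C * + 0) - B * (+ 0 - C * + 1)) + A * ((+ 0 - C * + 1) + B * (+ 1 - C * + 1 + C * + 0) - B * (+ 0 - C * + 1))) - + 1)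
  real⁻⁺⁻ = solve-∀

  real⁻⁻⁺ : ∀ A B C → (A + B) * C ≡ (A + B + A * B * C) + (
    (((+ 1 - C * + 0) - B * (+ 1 - C * + 0) + B * (+ 0 + C * + 1 - C * + 0)) - A * ((+ 1 - C * + 0) - B * (+ 1 - C * + 0) + B * (+ 0 + C * + 1 - C * + 0)) + A * ((+ 0 + C * + 1 - C * + 0) - B * (+ 1 - C * + 0))) - + 1)
  real⁻⁻⁺ = solve-∀

  real⁻⁻⁻ : ∀ A B C → A * B * C ≡ (A + B + C) + (
    (((+ 1 - C * + 1 + C * + 0) - B * (+ 1 - C * + 1 + C * + 0) + B * (+ 0 - C * + 1)) - A * ((+ 1 - C * + 1 + C * + 0) - B * (+ 1 - C * + 1 + C * + 0) + B * (+ 0 - C * + 1)) + A * ((+ 0 - C * + 1) - B * (+ 1 - C * + 1 + C * + 0))) - + 1)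
  real⁻⁻⁻ = solve-∀

  drop-zero : ∀ {P Q e} → P ≡ Q + (e - + 1) → e ≡ + 1 → P ≡ Q
  drop-zero {Q = Q} p refl = trans p (+-identityʳ Q)

  pos-*₃ : ∀ a b c → + (a ℕ.* b ℕ.* c) ≡ + a * + b * + c
  pos-*₃ a b c = trans (pos-* (a ℕ.* b) c) (cong (_* + c) (pos-* a b))

  m≢m+suc : ∀ {m n} → m ≢ m ℕ.+ suc n
  m≢m+suc {m} {n} e = ℕ.m≢1+m+n m (trans e (ℕ.+-suc m n))

  to-ℕ₀ : ∀ A B C → + A * + B * + C ≡ + A * + B + + B * + C + + C * + A → A ℕ.* B ℕ.* C ≡ A ℕ.* B ℕ.+ B ℕ.* C ℕ.+ C ℕ.* A
  to-ℕ₀ A B C e = +-injective (trans (pos-*₃ A B C) (trans e (sym (cong₂ _+_ (cong₂ _+_ (pos-* A B) (pos-* B C)) (pos-* C A)))))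

  to-ℕ₁ : ∀ A B C → (+ A + + B) * + C ≡ + A * + B + + C → (A ℕ.+ B) ℕ.* C ≡ A ℕ.* B ℕ.+ C
  to-ℕ₁ A B C e = +-injective (trans (pos-* (A ℕ.+ B) C) (trans e (cong (_+ + C) (sym (pos-* A B)))))

  to-ℕ₂ : ∀ A B C → (+ A + + B) * + C ≡ + A + + B + + A * + B * + C → (A ℕ.+ B) ℕ.* C ≡ A ℕ.+ B ℕ.+ A ℕ.* B ℕ.* C
  to-ℕ₂ A B C e = +-injective (trans (pos-* (A ℕ.+ B) C) (trans e (cong (λ m → + A + + B + m) (sym (pos-*₃ A B C)))))

  to-ℕ₃ : ∀ A B C → + A * + B * + C ≡ + A + + B + + C → A ℕ.* B ℕ.* C ≡ A ℕ.+ B ℕ.+ C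
  to-ℕ₃ A B C e = +-injective (trans (pos-*₃ A B C) e)

  expand₀ : ∀ a b c → (4 ℕ.+ a) ℕ.* (4 ℕ.+ b) ℕ.+ (4 ℕ.+ b) ℕ.* (4 ℕ.+ c) ℕ.+ (4 ℕ.+ c) ℕ.* (4 ℕ.+ a)
          ℕ.+ (16 ℕ.+ 8 ℕ.* (a ℕ.+ b ℕ.+ c) ℕ.+ 3 ℕ.* (a ℕ.* b ℕ.+ b ℕ.* c ℕ.+ c ℕ.* a) ℕ.+ a ℕ.* b ℕ.* c)
          ≡ (4 ℕ.+ a) ℕ.* (4 ℕ.+ b) ℕ.* (4 ℕ.+ c)
  expand₀ = ℕ-Ring.solve-∀

  -- After division by A B C this reads 1 = 1/A + 1/B + 1/C, whose right side is at most 3/4.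
  no-real₀ : ∀ {A B C} → 4 ℕ.≤ A → 4 ℕ.≤ B → 4 ℕ.≤ C → A ℕ.* B ℕ.* C ≢ A ℕ.* B ℕ.+ B ℕ.* C ℕ.+ C ℕ.* A
  no-real₀ A≥ B≥ C≥ e with a , refl ← ℕ.m≤n⇒∃[o]m+o≡n A≥ | b , refl ← ℕ.m≤n⇒∃[o]m+o≡n B≥ | c , refl ← ℕ.m≤n⇒∃[o]m+o≡n C≥ =
    m≢m+suc (trans (sym e) (sym (expand₀ a b c)))

  expand₁ : ∀ a b c → (suc a ℕ.+ suc b) ℕ.* suc c ≡ c ℕ.* (a ℕ.+ b ℕ.+ 1) ℕ.+ (a ℕ.+ b ℕ.+ 2 ℕ.+ c)
  expand₁ = ℕ-Ring.solve-∀

  expand₁′ : ∀ a b c → suc a ℕ.* suc b ℕ.+ suc c ≡ a ℕ.* b ℕ.+ (a ℕ.+ b ℕ.+ 2 ℕ.+ c)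
  expand₁′ = ℕ-Ring.solve-∀

  a+b+1≢b : ∀ a b → a ℕ.+ b ℕ.+ 1 ≢ b
  a+b+1≢b a b e = ℕ.m≢1+n+m b (sym (trans (ℕ.+-comm 1 (a ℕ.+ b)) e))

  -- The equation says (a - c)(b - c) = c (c + 1); as c is prime it divides a - c or b - c,
  -- hence equals the prime a or b.
  no-real₁ : ∀ {a b c} → Prime a → Prime b → Prime c →
             (suc a ℕ.+ suc b) ℕ.* suc c ≢ suc a ℕ.* suc b ℕ.+ suc c
  no-real₁ {a} {b} {c} pa pb pc e = cases (euclidsLemma a b pc (ℕ.divides (a ℕ.+ b ℕ.+ 1) (trans (sym eq) (ℕ.*-comm c _))))
    where
    eq : c ℕ.* (a ℕ.+ b ℕ.+ 1) ≡ a ℕ.* b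
    eq = ℕ.+-cancelʳ-≡ (a ℕ.+ b ℕ.+ 2 ℕ.+ c) _ _ (trans (sym (expand₁ a b c)) (trans e (expand₁′ a b c)))
    prime-divisor : ∀ {p} → Prime p → c ℕ.∣ p → c ≡ p
    prime-divisor pp d with prime⇒irreducible pp d
    ... | inj₁ refl = ⊥-elim (¬prime[1] pc)
    ... | inj₂ c≡p = c≡p
    cases : c ℕ.∣ a ⊎ c ℕ.∣ b → ⊥
    cases (inj₁ d) with refl ← prime-divisor pa d =
      a+b+1≢b a b (ℕ.*-cancelˡ-≡ _ _ a ⦃ prime⇒nonZero pa ⦄ eq)
    cases (inj₂ d) with refl ← prime-divisor pb d =
      a+b+1≢b b a (trans (cong (ℕ._+ 1) (ℕ.+-comm b a)) (ℕ.*-cancelˡ-≡ _ _ b ⦃ prime⇒nonZero pb ⦄ (trans eq (ℕ.*-comm a b))))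

  expand₂ : ∀ a b C → (4 ℕ.+ a ℕ.+ (4 ℕ.+ b)) ℕ.* C ℕ.+ (8 ℕ.+ a ℕ.+ b ℕ.+ (8 ℕ.+ 3 ℕ.* a ℕ.+ 3 ℕ.* b ℕ.+ a ℕ.* b) ℕ.* C)
          ≡ 4 ℕ.+ a ℕ.+ (4 ℕ.+ b) ℕ.+ (4 ℕ.+ a) ℕ.* (4 ℕ.+ b) ℕ.* C
  expand₂ = ℕ-Ring.solve-∀

  -- A B ≥ A + B, so the right side exceeds the left by at least A + B.
  no-real₂ : ∀ {A B} C → 4 ℕ.≤ A → 4 ℕ.≤ B → (A ℕ.+ B) ℕ.* C ≢ A ℕ.+ B ℕ.+ A ℕ.* B ℕ.* C
  no-real₂ C A≥ B≥ e with a , refl ← ℕ.m≤n⇒∃[o]m+o≡n A≥ | b , refl ← ℕ.m≤n⇒∃[o]m+o≡n B≥ =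
    m≢m+suc (trans e (sym (expand₂ a b C)))

  expand₃ : ∀ a b c → (4 ℕ.+ a ℕ.+ (4 ℕ.+ b) ℕ.+ (4 ℕ.+ c)) ℕ.+ (52 ℕ.+ 15 ℕ.* (a ℕ.+ b ℕ.+ c) ℕ.+ 4 ℕ.* (a ℕ.* b ℕ.+ b ℕ.* c ℕ.+ c ℕ.* a) ℕ.+ a ℕ.* b ℕ.* c)
          ≡ (4 ℕ.+ a) ℕ.* (4 ℕ.+ b) ℕ.* (4 ℕ.+ c)
  expand₃ = ℕ-Ring.solve-∀

  no-real₃ : ∀ {A B C} → 4 ℕ.≤ A → 4 ℕ.≤ B → 4 ℕ.≤ C → A ℕ.* B ℕ.* C ≢ A ℕ.+ B ℕ.+ C
  no-real₃ A≥ B≥ C≥ e with a , refl ← ℕ.m≤n⇒∃[o]m+o≡n A≥ | b , refl ← ℕ.m≤n⇒∃[o]m+o≡n B≥ | c , refl ← ℕ.m≤n⇒∃[o]m+o≡n C≥ =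
    m≢m+suc (trans (sym e) (sym (expand₃ a b c)))

  norm-suc : ∀ x → + 1 * + 1 - + 1 * (+ 1 + x) + (+ 1 + x) * (+ 1 + x) ≡ x * x + x + + 1
  norm-suc = solve-∀

  poly-suc : ∀ x → x * x + x + + 1 ≡ (+ 1 + x) * (+ 1 + x) - (+ 1 + x) + + 1
  poly-suc = solve-∀

  Φ-ℤ : ∀ a → + Φ a ≡ + a * + a + + a + + 1
  Φ-ℤ a = cong (λ m → m + + a + + 1) (pos-* a a)

  3∣suc : ∀ {a} i → a ≡ 2 ℕ.+ i ℕ.* 3 → + 3 ∣ + suc a
  3∣suc i refl = ∣ᵤ⇒∣ (ℕ.divides (suc i) refl)

  no-triple-Φ-value : ∀ {a b c y i j k l} → Prime a → Prime b → Prime c →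
    Prime (Φ a) → Prime (Φ b) → Prime (Φ c) → 3 ℕ.≤ a → 3 ℕ.≤ b → 3 ℕ.≤ c →
    a ≡ 2 ℕ.+ i ℕ.* 3 → b ≡ 2 ℕ.+ j ℕ.* 3 → c ≡ 2 ℕ.+ k ℕ.* 3 → y ≡ 2 ℕ.+ l ℕ.* 3 →
    Φ y ≢ Φ a ℕ.* (Φ b ℕ.* Φ c)
  no-triple-Φ-value {a} {b} {c} {y} {i} {j} {k} {l} pa pb pc pΦa pΦb pΦc 3≤a 3≤b 3≤c ea eb ec ey e
    -- 1 + (y + 1) ω is primary of norm `Φ y`. Splitting off the three prime norms leaves a primary
    -- element of norm 1, hence 1 itself.
    = step₁ (divide pΦa A (trans (Φ-ℤ a) (poly-suc (+ a))) (+ 1) Y (+ (Φ b ℕ.* Φ c))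
               (trans (norm-suc (+ y)) (trans (sym (Φ-ℤ y)) (trans (cong +_ (trans e (ℕ.*-comm (Φ a) (Φ b ℕ.* Φ c)))) (pos-* (Φ b ℕ.* Φ c) (Φ a))))))
    where
    A = + suc a
    B = + suc b
    C = + suc c
    Y = + suc y
    primary : ∀ D γ δ → + 3 ∣ D → Primary δ → times D γ ≡ δ ⊎ times′ D γ ≡ δ → Primary γ
    primary D γ δ d p (inj₁ e) = times-primary D γ d (subst Primary (sym e) p)
    primary D γ δ d p (inj₂ e) = times′-primary D γ d (subst Primary (sym e) p)
    IsProduct : ℤ → ℤ × ℤ → ℤ × ℤ → Set
    IsProduct D γ δ = times D γ ≡ δ ⊎ times′ D γ ≡ δ
    real : ∀ {x y : ℤ × ℤ} → x ≡ y → proj₁ x ≡ proj₁ y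
    real = cong proj₁
    finish : ∀ {γ₁ γ₂} → IsProduct A γ₁ (+ 1 , Y) → IsProduct B γ₂ γ₁ → IsProduct C (+ 1 , + 0) γ₂ → ⊥
    -- The number of conjugated factors decides which equation arises: none, one, two or three lead
    -- to `no-real₀`, `no-real₁`, `no-real₂`, `no-real₃`.
    finish (inj₁ t₁) (inj₁ refl) (inj₁ refl) = no-real₀ (s≤s 3≤a) (s≤s 3≤b) (s≤s 3≤c)
      (to-ℕ₀ (suc a) (suc b) (suc c) (drop-zero (real⁺⁺⁺ A B C) (real t₁)))
    finish (inj₁ t₁) (inj₁ refl) (inj₂ refl) = no-real₁ pa pb pc
      (to-ℕ₁ (suc a) (suc b) (suc c) (drop-zero (real⁺⁺⁻ A B C) (real t₁)))
    finish (inj₁ t₁) (inj₂ refl) (inj₁ refl) = no-real₁ pa pc pb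
      (to-ℕ₁ (suc a) (suc c) (suc b) (drop-zero (real⁺⁻⁺ A B C) (real t₁)))
    finish (inj₁ t₁) (inj₂ refl) (inj₂ refl) = no-real₂ (suc a) (s≤s 3≤b) (s≤s 3≤c)
      (to-ℕ₂ (suc b) (suc c) (suc a) (drop-zero (real⁺⁻⁻ A B C) (real t₁)))
    finish (inj₂ t₁) (inj₁ refl) (inj₁ refl) = no-real₁ pb pc pa
      (to-ℕ₁ (suc b) (suc c) (suc a) (drop-zero (real⁻⁺⁺ A B C) (real t₁)))
    finish (inj₂ t₁) (inj₁ refl) (inj₂ refl) = no-real₂ (suc b) (s≤s 3≤a) (s≤s 3≤c)
      (to-ℕ₂ (suc a) (suc c) (suc b) (drop-zero (real⁻⁺⁻ A B C) (real t₁)))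
    finish (inj₂ t₁) (inj₂ refl) (inj₁ refl) = no-real₂ (suc c) (s≤s 3≤a) (s≤s 3≤b)
      (to-ℕ₂ (suc a) (suc b) (suc c) (drop-zero (real⁻⁻⁺ A B C) (real t₁)))
    finish (inj₂ t₁) (inj₂ refl) (inj₂ refl) = no-real₃ (s≤s 3≤a) (s≤s 3≤b) (s≤s 3≤c)
      (to-ℕ₃ (suc a) (suc b) (suc c) (drop-zero (real⁻⁻⁻ A B C) (real t₁)))
    step₃ : ∀ γ₁ γ₂ γ₃ → IsProduct A γ₁ (+ 1 , Y) → IsProduct B γ₂ γ₁ → IsProduct C γ₃ γ₂ → norm γ₃ ≡ + 1 → ⊥
    step₃ γ₁ γ₂ γ₃ t₁ t₂ t₃ n₃ = finish t₁ t₂ (subst (λ γ → IsProduct C γ γ₂) (primary-unit γ₃ p₃ n₃) t₃)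
      where
      p₁ = primary A γ₁ (+ 1 , Y) (3∣suc i ea) (divides (+ 0) refl , 3∣suc l ey) t₁
      p₂ = primary B γ₂ γ₁ (3∣suc j eb) p₁ t₂
      p₃ = primary C γ₃ γ₂ (3∣suc k ec) p₂ t₃
    step₂ : ∀ γ₁ γ₂ → IsProduct A γ₁ (+ 1 , Y) → IsProduct B γ₂ γ₁ → norm γ₂ ≡ + Φ c → ⊥
    step₂ γ₁ γ₂ t₁ t₂ n₂ = (λ (γ₃ , n₃ , t₃) → step₃ γ₁ γ₂ γ₃ t₁ t₂ t₃ n₃)
      (divide pΦc C (trans (Φ-ℤ c) (poly-suc (+ c))) (proj₁ γ₂) (proj₂ γ₂) (+ 1) (trans n₂ (sym (*-identityˡ (+ Φ c)))))
    step₁ : Quotient pΦa A (trans (Φ-ℤ a) (poly-suc (+ a))) (+ 1) Y (+ (Φ b ℕ.* Φ c)) → ⊥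
    step₁ (γ₁ , n₁ , t₁) = (λ (γ₂ , n₂ , t₂) → step₂ γ₁ γ₂ t₁ t₂ n₂)
      (divide pΦb B (trans (Φ-ℤ b) (poly-suc (+ b))) (proj₁ γ₁) (proj₂ γ₁) (+ Φ c) (trans n₁ (trans (cong +_ (ℕ.*-comm (Φ b) (Φ c))) (pos-* (Φ c) (Φ b)))))

open Eisenstein using (no-triple-Φ-value)
open import Data.Nat
open import Data.Nat.Properties
open import Data.Nat.Divisibility
open import Data.Nat.Coprimality using (Coprime; coprime-divisor)
open import Data.Nat.DivMod using (_/_; _%_; m≡m%n+[m/n]*n; m%n<n; [m+kn]%n≡m%n)
open import Data.Nat.Induction using (<-rec)
open import Data.Nat.ListAction using (sum; product)
open import Data.Nat.ListAction.Properties using (sum-++; sum-↭; product-++; ∈⇒∣product)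
open import Data.Nat.Primality.Factorisation using (factorise; PrimeFactorisation)
open import Data.Nat.Tactic.RingSolver using (solve-∀)
open import Data.Bool using (if_then_else_)
open import Data.List using (List; []; _∷_; map; filter; length; _++_; upTo)
open import Data.List.Properties using (map-cong; map-++; map-id; length-map; length-upTo)
open import Data.List.Membership.Propositional using (_∈_; find; lose)
open import Data.List.Membership.Propositional.Properties using (∈-filter⁺; ∈-filter⁻; ∈-map⁺; ∈-map⁻; ∈-upTo⁺; ∈-upTo⁻; ∈-++⁺ˡ; ∈-++⁺ʳ; ∈-++⁻)
open import Data.List.Membership.Propositional.Properties.WithK using (unique∧set⇒bag)
open import Data.List.Relation.Binary.BagAndSetEquality using (∼bag⇒↭)
open import Data.List.Relation.Binary.Permutation.Propositional using (_↭_)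
open import Data.List.Relation.Binary.Permutation.Propositional.Properties using (↭-length)
open import Data.List.Relation.Unary.All as All using (All; []; _∷_)
import Data.List.Relation.Unary.All.Properties as All
open import Data.List.Relation.Unary.AllPairs using ([]; _∷_)
open import Data.List.Relation.Unary.Any using (Any; here; there; any?)
open import Data.List.Relation.Unary.Unique.Propositional using (Unique)
import Data.List.Relation.Unary.Unique.Propositional.Properties as Unique
open import Relation.Binary.Definitions using (tri<; tri≈; tri>)
open import Relation.Nullary.Decidable using (_×-dec_; from-yes)
open import Relation.Unary using (Decidable; Pred)

-- Divisors of x² + x + 1

%3⇒ : ∀ x s → x % 3 ≡ s → x ≡ s + (x / 3) * 3
%3⇒ x s e = trans (m≡m%n+[m/n]*n x 3) (cong (_+ (x / 3) * 3) e)

%3-cases : ∀ x → x % 3 ≡ 0 ⊎ x % 3 ≡ 1 ⊎ x % 3 ≡ 2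
%3-cases x with x % 3 | m%n<n x 3
... | 0 | _ = inj₁ refl
... | 1 | _ = inj₂ (inj₁ refl)
... | 2 | _ = inj₂ (inj₂ refl)
... | suc (suc (suc _)) | s≤s (s≤s (s≤s ()))

data Residue₃ (x : ℕ) : Set where
  res₀ : ∀ k → x ≡ k * 3 → Residue₃ x
  res₁ : ∀ k → x ≡ 1 + k * 3 → Residue₃ x
  res₂ : ∀ k → x ≡ 2 + k * 3 → Residue₃ x

residue₃ : ∀ x → Residue₃ x
residue₃ x with %3-cases x
... | inj₁ e = res₀ (x / 3) (%3⇒ x 0 e)
... | inj₂ (inj₁ e) = res₁ (x / 3) (%3⇒ x 1 e)
... | inj₂ (inj₂ e) = res₂ (x / 3) (%3⇒ x 2 e)

residue-unique : ∀ r s a b → r + a * 3 ≡ s + b * 3 → r % 3 ≡ s % 3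
residue-unique r s a b e =
  trans (sym ([m+kn]%n≡m%n r a 3)) (trans (cong (_% 3) e) ([m+kn]%n≡m%n s b 3))

1+2k-odd : ∀ k → Odd (1 + k * 2)
1+2k-odd k (divides l e)
  with () ← trans (sym ([m+kn]%n≡m%n 1 k 2)) (trans (cong (_% 2) e) ([m+kn]%n≡m%n 0 l 2))

even-or-odd : ∀ x → (∃ λ k → x ≡ k * 2) ⊎ (∃ λ k → x ≡ 1 + k * 2)
even-or-odd x with x % 2 | m≡m%n+[m/n]*n x 2 | m%n<n x 2
... | 0 | eq | _ = inj₁ (x / 2 , eq)
... | 1 | eq | _ = inj₂ (x / 2 , eq)
... | suc (suc _) | _ | s≤s (s≤s ())

odd⇒1+2k : ∀ {x} → Odd x → ∃ λ k → x ≡ 1 + k * 2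
odd⇒1+2k {x} o with even-or-odd x
... | inj₁ (k , e) = ⊥-elim (o (divides k e))
... | inj₂ r = r

Φ[k*2] : ∀ k → 1 + (k * (k * 2) + k) * 2 ≡ ((k * 2) * (k * 2) + (k * 2) + 1)
Φ[k*2] = solve-∀

Φ[1+k*2] : ∀ k → 1 + (1 + 3 * k + 2 * (k * k)) * 2 ≡ ((1 + k * 2) * (1 + k * 2) + (1 + k * 2) + 1)
Φ[1+k*2] = solve-∀

Φ-odd : ∀ x → Odd (Φ x)
Φ-odd x with even-or-odd x
... | inj₁ (k , refl) = subst Odd (Φ[k*2] k) (1+2k-odd (k * (k * 2) + k))
... | inj₂ (k , refl) = subst Odd (Φ[1+k*2] k) (1+2k-odd (1 + 3 * k + 2 * (k * k)))

Φ-mono-< : ∀ {x y} → x < y → Φ x < Φ y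
Φ-mono-< x<y = +-monoˡ-< 1 (+-mono-≤-< (*-mono-≤ (<⇒≤ x<y) (<⇒≤ x<y)) x<y)

-- The source of all root arguments: modulo a prime, two roots of `Φ` are congruent or add up to -1.
Φ-shift : ∀ b d → ((b + d) * (b + d) + (b + d) + 1) ≡ (b * b + b + 1) + d * (b + (b + d) + 1)
Φ-shift = solve-∀

∣m+n∣n⇒∣m : ∀ {i m n} → i ∣ m + n → i ∣ n → i ∣ m
∣m+n∣n⇒∣m {i} {m} {n} h = ∣m+n∣m⇒∣n (subst (i ∣_) (+-comm m n) h)

n∣Φ-shift : ∀ {n} x t → n ∣ Φ (x + t * n) → n ∣ Φ x
n∣Φ-shift {n} x t h =
  ∣m+n∣n⇒∣m (subst (n ∣_) (Φ-shift x (t * n)) h) (∣-trans (n∣m*n t) (m∣m*n _))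

+-rotate : ∀ y d → (y + d) + y + 1 ≡ y + (y + d) + 1
+-rotate = solve-∀

n∣Φ-reflect : ∀ {n} x y → x + y + 1 ≡ n → n ∣ Φ x → n ∣ Φ y
n∣Φ-reflect {n} x y e h with ≤-total x y
... | inj₁ x≤y with d , refl ← m≤n⇒∃[o]m+o≡n x≤y =
  subst (n ∣_) (sym (Φ-shift x d)) (∣m∣n⇒∣m+n h (subst (λ m → n ∣ d * m) (sym e) (n∣m*n d)))
... | inj₂ y≤x with d , refl ← m≤n⇒∃[o]m+o≡n y≤x =
  ∣m+n∣n⇒∣m (subst (n ∣_) (Φ-shift y d) h) (subst (λ m → n ∣ d * m) (trans (sym e) (+-rotate y d)) (n∣m*n d))

Φ[k*3] : ∀ k → ((k * 3) * (k * 3) + (k * 3) + 1) ≡ 1 + (k * (k * 3) + k) * 3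
Φ[k*3] = solve-∀

Φ[1+k*3] : ∀ k → ((1 + k * 3) * (1 + k * 3) + (1 + k * 3) + 1) ≡ 3 * (1 + (k + k * k) * 3)
Φ[1+k*3] = solve-∀

Φ[2+k*3] : ∀ k → ((2 + k * 3) * (2 + k * 3) + (2 + k * 3) + 1) ≡ 1 + (2 + 5 * k + 3 * (k * k)) * 3
Φ[2+k*3] = solve-∀

Φ+x≡[1+x]² : ∀ x → (x * x + x + 1) + x ≡ (1 + x) * (1 + x)
Φ+x≡[1+x]² = solve-∀

Φ<square : ∀ {x n} → 1 < n → x < n → Φ x < n * n
Φ<square {zero} 1<n _ = ≤-trans 1<n (m≤m*n _ _ ⦃ >-nonZero (<⇒≤ 1<n) ⦄)
Φ<square {suc x} _ x<n = ≤-trans (m<m+n _ z<s) (≤-trans (≤-reflexive (Φ+x≡[1+x]² (suc x))) (*-mono-≤ x<n x<n))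

2*1≡2 : ∀ k j → 2 + (2 * j + k * (1 + j * 3)) * 3 ≡ (2 + k * 3) * (1 + j * 3)
2*1≡2 = solve-∀

cofactor≡2 : ∀ k m i → (2 + k * 3) * m ≡ 1 + i * 3 → ∃ λ j → m ≡ 2 + j * 3
cofactor≡2 k m i e with residue₃ m
... | res₀ j refl with () ← residue-unique 0 1 ((2 + k * 3) * j) i (trans (*-assoc (2 + k * 3) j 3) e)
... | res₁ j refl with () ← residue-unique 2 1 (2 * j + k * (1 + j * 3)) i (trans (2*1≡2 k j) e)
... | res₂ j e′ = j , e′

3+[i+j]*3 : ∀ i j → 3 + (i + j) * 3 ≡ 1 + (1 + i * 3) + (1 + j * 3)
3+[i+j]*3 = solve-∀

4+[i+j]*3 : ∀ i j → 4 + (i + j) * 3 ≡ 1 + (1 + i * 3) + (2 + j * 3)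
4+[i+j]*3 = solve-∀

-- Infinite descent: reduce x modulo n and, if x ≡ 1 (mod 3), replace it by n - 1 - x;
-- then Φ x ≡ 1 (mod 3), so the cofactor of n is smaller than n and again ≡ 2 (mod 3).
≡2⇒∤Φ : ∀ n k → n ≡ 2 + k * 3 → ∀ x → ¬ (n ∣ Φ x)
≡2⇒∤Φ = <-rec _ step
  where
  step : ∀ n → (∀ {m} → m < n → ∀ k → m ≡ 2 + k * 3 → ∀ x → ¬ (m ∣ Φ x)) →
         ∀ k → n ≡ 2 + k * 3 → ∀ x → ¬ (n ∣ Φ x)
  step n rec k refl x h = cases (residue₃ x′) (m%n<n x n)
      (n∣Φ-shift x′ (x / n) (subst (λ y → n ∣ Φ y) (m≡m%n+[m/n]*n x n) h))
    where
    x′ = x % n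
    main : ∀ y i → y < n → Φ y ≡ 1 + i * 3 → n ∣ Φ y → ⊥
    main y i y<n e (divides m e′) with j , e″ ← cofactor≡2 k m i (trans (*-comm n m) (trans (sym e′) e)) =
      rec (*-cancelʳ-< n m n (subst (_< n * n) e′ (Φ<square (s≤s (s≤s z≤n)) y<n))) j e″ y
        (divides n (trans e′ (*-comm m n)))
    cases : ∀ {y} → Residue₃ y → y < n → n ∣ Φ y → ⊥
    cases (res₀ i refl) y<n d = main (i * 3) (i * (i * 3) + i) y<n (Φ[k*3] i) d
    cases (res₂ i refl) y<n d = main (2 + i * 3) (2 + 5 * i + 3 * (i * i)) y<n (Φ[2+k*3] i) d
    cases {y} (res₁ i refl) y<n d with z , e ← m≤n⇒∃[o]m+o≡n y<n with residue₃ z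
    ... | res₀ j refl = main (j * 3) (j * (j * 3) + j) (subst (j * 3 <_) e (s≤s (m≤n+m (j * 3) y))) (Φ[k*3] j)
            (n∣Φ-reflect y (j * 3) (trans (+-comm (y + j * 3) 1) e) d)
    ... | res₁ j refl with () ← residue-unique 3 2 (i + j) k (trans (3+[i+j]*3 i j) e)
    ... | res₂ j refl with () ← residue-unique 4 2 (i + j) k (trans (4+[i+j]*3 i j) e)

Φ-roots : ∀ {r} → Prime r → ∀ b d → r ∣ Φ b → r ∣ Φ (b + d) → r ∣ d ⊎ r ∣ (b + (b + d) + 1)
Φ-roots {r} rp b d rb ry = euclidsLemma d (b + (b + d) + 1) rp
  (∣m+n∣m⇒∣n (subst (r ∣_) (Φ-shift b d) ry) rb)

≤-by : ∀ {m n} k → m + k ≡ n → m ≤ n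
≤-by k refl = m≤m+n _ k

∣∧<2*⇒≡ : ∀ {r n} → r ∣ n → 0 < n → n < 2 * r → n ≡ r
∣∧<2*⇒≡ (divides 0 refl) () _
∣∧<2*⇒≡ (divides 1 e) _ _ = trans e (+-identityʳ _)
∣∧<2*⇒≡ {r} (divides (suc (suc k)) refl) _ h = ⊥-elim (<⇒≱ h (*-monoˡ-≤ r {2} {2 + k} (s≤s (s≤s z≤n))))

-- Both roots lie below r, so r divides not their difference but x + y + 1, which lies strictly
-- between 0 and 2 r.
root-difference : ∀ {r} → Prime r → ∀ {x y} → x < y → y < r → r ∣ Φ x → r ∣ Φ y → x + y + 1 ≡ r
root-difference {r} rp {x} {y} x<y y<r rx ry with d , refl ← m≤n⇒∃[o]m+o≡n x<y
  with Φ-roots rp x (suc d) rx (subst (λ m → r ∣ Φ m) (sym (+-suc x d)) ry)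
... | inj₁ r∣d = ⊥-elim (<⇒≱ y<r (≤-trans (∣⇒≤ r∣d) (s≤s (m≤n+m d x))))
... | inj₂ r∣s = ∣∧<2*⇒≡ (subst (λ m → r ∣ x + m + 1) (+-suc x d) r∣s)
  (subst (0 <_) (+-comm 1 (x + y)) z<s) (begin-strict
    x + y + 1   ≡⟨ +-comm (x + y) 1 ⟩
    suc x + y   <⟨ +-mono-≤-< (≤-trans x<y (<⇒≤ y<r)) y<r ⟩
    r + r       ≡⟨ cong (r +_) (+-identityʳ r) ⟨
    2 * r       ∎)
  where open ≤-Reasoning

[2+i*3]+[2+j*3]+1 : ∀ i j → (2 + i * 3) + (2 + j * 3) + 1 ≡ 2 + (1 + i + j) * 3
[2+i*3]+[2+j*3]+1 = solve-∀

-- Two different roots would give r = x + y + 1 ≡ 2 (mod 3), and such an r divides no value of `Φ`.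
≡2-root-unique : ∀ {r} → Prime r → ∀ {x y i j} → x ≡ 2 + i * 3 → y ≡ 2 + j * 3 →
                 x < r → y < r → r ∣ Φ x → r ∣ Φ y → x ≡ y
≡2-root-unique {r} rp {x} {y} {i} {j} refl refl x<r y<r rx ry with <-cmp x y
... | tri≈ _ e _ = e
... | tri< x<y _ _ = ⊥-elim (≡2⇒∤Φ r (1 + i + j) (trans (sym (root-difference rp x<y y<r rx ry)) ([2+i*3]+[2+j*3]+1 i j)) x rx)
... | tri> _ _ y<x = ⊥-elim (≡2⇒∤Φ r (1 + j + i) (trans (sym (root-difference rp y<x x<r ry rx)) ([2+i*3]+[2+j*3]+1 j i)) x rx)

Φ-cancel-< : ∀ {x y} → Φ x < Φ y → x < y
Φ-cancel-< {x} {y} h with <-cmp x y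
... | tri< x<y _ _ = x<y
... | tri≈ _ refl _ = ⊥-elim (<-irrefl refl h)
... | tri> _ _ y<x = ⊥-elim (<-asym h (Φ-mono-< y<x))

Φ-injective : ∀ {x y} → Φ x ≡ Φ y → x ≡ y
Φ-injective {x} {y} e with <-cmp x y
... | tri< x<y _ _ = ⊥-elim (<⇒≢ (Φ-mono-< x<y) e)
... | tri≈ _ x≡y _ = x≡y
... | tri> _ _ y<x = ⊥-elim (<⇒≢ (Φ-mono-< y<x) (sym e))

odd+Φ : ∀ k → (1 + k * 2) + ((1 + k * 2) * (1 + k * 2) + (1 + k * 2) + 1) ≡ (2 * (1 + k) * (1 + k)) * 2
odd+Φ = solve-∀

odd+odd+1 : ∀ k l → 1 + (1 + k + l) * 2 ≡ (1 + k * 2) + (1 + l * 2) + 1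
odd+odd+1 = solve-∀

b+[b+d]+1 : ∀ b d → b + (b + d) + 1 ≡ (1 + (b + d)) + b
b+[b+d]+1 = solve-∀

Φ≡b+_ : ∀ b → b * b + b + 1 ≡ (1 + b * b) + b
Φ≡b+_ = solve-∀

b<b*b : ∀ {b} → Prime b → b < b * b
b<b*b {b} bp = m<m*n b b ⦃ prime⇒nonZero bp ⦄ (nonTrivial⇒n>1 b ⦃ prime⇒nonTrivial bp ⦄)

1+b+b*b : ∀ b → 1 + b + b * b ≡ b * b + b + 1
1+b+b*b = solve-∀

b+y+1 : ∀ b y → b + y + 1 ≡ y + (1 + b)
b+y+1 = solve-∀

4*r*r : ∀ r → 4 * r * r ≡ 2 * r * (2 * r)
4*r*r = solve-∀

-- The roots of Φ modulo r = Φ b are b and b², so an odd prime y > b that is a root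
-- has the form b + k r with k even, or b² + k r with k even and nonzero.
root-of-Φ-value : ∀ {b y} → Prime b → Odd b → Prime y → Odd y → Prime (Φ b) → b < y →
                  Φ b ∣ Φ y → 2 * Φ b ≤ y
root-of-Φ-value {b} {y} bp bo yp yo rp b<y r∣ with k , ek ← odd⇒1+2k bo | d , refl ← m≤n⇒∃[o]m+o≡n (<⇒≤ b<y)
  with Φ-roots rp b d ∣-refl r∣
... | inj₁ (divides 0 refl) = ⊥-elim (<-irrefl (sym (+-identityʳ b)) b<y)
... | inj₁ (divides 1 refl) = ⊥-elim (yo (subst (2 ∣_) (cong (λ c → c + (Φ c + 0)) (sym ek))
        (subst (λ m → 2 ∣ 1 + k * 2 + m) (sym (+-identityʳ _)) (divides (2 * (1 + k) * (1 + k)) (odd+Φ k)))))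
... | inj₁ (divides (suc (suc c)) refl) = ≤-trans (*-monoˡ-≤ (Φ b) {2} {2 + c} (s≤s (s≤s z≤n))) (m≤n+m _ b)
... | inj₂ (divides 0 e) = ⊥-elim (case trans (+-comm 1 (b + (b + d))) e of λ ())
... | inj₂ (divides 1 e) = ⊥-elim (prime⇒¬composite yp (subst Composite (sym y≡bb)
        (hasNonTrivialDivisor ⦃ prime⇒nonTrivial bp ⦄ (b<b*b bp) (m∣m*n b))))
  where
  y≡bb : b + d ≡ b * b
  y≡bb = suc-injective (+-cancelʳ-≡ b _ _ (trans (sym (b+[b+d]+1 b d)) (trans e (trans (+-identityʳ _) (Φ≡b+ b)))))
... | inj₂ (divides 2 e) with l , el ← odd⇒1+2k yo = ⊥-elim (1+2k-odd (1 + k + l)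
        (divides (Φ b) (trans (odd+odd+1 k l) (trans (cong₂ (λ m n → m + n + 1) (sym ek) (sym el)) (trans e (*-comm 2 (Φ b)))))))
... | inj₂ (divides (suc (suc (suc c))) e) = +-cancelʳ-≤ (1 + b) _ _ (begin
    2 * Φ b + (1 + b)    ≤⟨ +-monoʳ-≤ (2 * Φ b) (≤-by (b * b) (1+b+b*b b)) ⟩
    2 * Φ b + Φ b        ≡⟨ +-comm (2 * Φ b) (Φ b) ⟩
    3 * Φ b              ≤⟨ *-monoˡ-≤ (Φ b) {3} {3 + c} (s≤s (s≤s (s≤s z≤n))) ⟩
    (3 + c) * Φ b        ≡⟨ e ⟨
    b + (b + d) + 1      ≡⟨ b+y+1 b (b + d) ⟩
    b + d + (1 + b)      ∎)
  where open ≤-Reasoning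

-- As m > 1, y exceeds b, so y ≥ 2 r for r = Φ b and Φ y > 4 r². The allowance 3 r for m covers Φ y
-- = 3 p r with p ≤ r, which occurs for y ≡ 1 (mod 3).
no-Φ-value-factor : ∀ {b y m} → Prime b → Odd b → Prime y → Odd y → Prime (Φ b) →
                    1 < m → m ≤ 3 * Φ b → Φ y ≢ m * Φ b
no-Φ-value-factor {b} {y} {m} bp bo yp yo rp 1<m m≤3r e = <-irrefl refl (begin-strict
    m * r              ≤⟨ *-monoˡ-≤ r m≤3r ⟩
    3 * r * r          ≤⟨ *-monoˡ-≤ r (*-monoˡ-≤ r {3} {4} (s≤s (s≤s (s≤s z≤n)))) ⟩
    4 * r * r          ≡⟨ 4*r*r r ⟩
    2 * r * (2 * r)    ≤⟨ *-mono-≤ 2r≤y 2r≤y ⟩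
    y * y              ≤⟨ m≤m+n (y * y) y ⟩
    y * y + y          <⟨ m<m+n _ z<s ⟩
    Φ y                ≡⟨ e ⟩
    m * r              ∎)
  where
  open ≤-Reasoning
  r = Φ b
  r<Φy : r < Φ y
  r<Φy = subst (r <_) (sym e) (subst (r <_) (*-comm r m) (m<m*n r m ⦃ prime⇒nonZero rp ⦄ 1<m))
  2r≤y = root-of-Φ-value bp bo yp yo rp (Φ-cancel-< r<Φy) (divides m e)

-- Otherwise p r ≤ y² < Φ y. Hence the larger of two prime factors of `Φ y` always exceeds y and
-- owes y a bonus.
root<cofactor-bound : ∀ {y p r} → Φ y ≡ p * r → p ≤ r → y < r
root<cofactor-bound {y} {p} {r} e p≤r with y <? r
... | yes y<r = y<r
... | no y≮r = ⊥-elim (<-irrefl refl (begin-strict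
  p * r      ≤⟨ *-mono-≤ (≤-trans p≤r (≮⇒≥ y≮r)) (≮⇒≥ y≮r) ⟩
  y * y      ≤⟨ m≤m+n (y * y) y ⟩
  y * y + y  <⟨ m<m+n _ z<s ⟩
  Φ y        ≡⟨ e ⟩
  p * r      ∎))
  where open ≤-Reasoning

Φ≡3r⇒<r : ∀ {z r} → 3 ≤ z → Φ z ≡ 3 * r → z < r
Φ≡3r⇒<r {z} {r} 3≤z e = *-cancelˡ-< 3 z r (begin-strict
  3 * z      ≤⟨ *-monoˡ-≤ z 3≤z ⟩
  z * z      ≤⟨ m≤m+n (z * z) z ⟩
  z * z + z  <⟨ m<m+n _ z<s ⟩
  Φ z        ≡⟨ e ⟩
  3 * r      ∎)
  where open ≤-Reasoning

-- For r = y + z + 1 and 3 r = Φ z this gives (p + 2 z) r = (r + 2) r.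
cofactor-expand : ∀ y z → (y * y + y + 1) + 2 * z * (y + z + 1) + (3 * (y + z + 1))
       ≡ (y + z + 3) * (y + z + 1) + (z * z + z + 1)
cofactor-expand = solve-∀

cofactor-collect : ∀ p r z → p * r + 2 * z * r ≡ (p + z + z) * r
cofactor-collect = solve-∀

+-swap-3 : ∀ y z → y + z + 3 ≡ y + 3 + z
+-swap-3 = solve-∀

third-image-cofactor : ∀ {y z p r} → .⦃ NonZero r ⦄ → y + z + 1 ≡ r → Φ z ≡ 3 * r → Φ y ≡ p * r → p + z ≡ y + 3
third-image-cofactor {y} {z} {p} {r} refl ez ey = +-cancelʳ-≡ z _ _ (trans (*-cancelʳ-≡ _ _ r eq) (+-swap-3 y z))
  where
  open ≡-Reasoning
  eq : (p + z + z) * r ≡ (y + z + 3) * r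
  eq = +-cancelʳ-≡ (3 * r) _ _ (begin
    (p + z + z) * r + 3 * r          ≡⟨ cong (_+ 3 * r) (cofactor-collect p r z) ⟨
    p * r + 2 * z * r + 3 * r        ≡⟨ cong (λ m → m + 2 * z * r + 3 * r) ey ⟨
    Φ y + 2 * z * r + 3 * r          ≡⟨ cofactor-expand y z ⟩
    (y + z + 3) * r + Φ z            ≡⟨ cong ((y + z + 3) * r +_) ez ⟩
    (y + z + 3) * r + 3 * r          ∎)

3*[y+z+1]+15 : ∀ y z → 3 * (y + z + 1) + 15 ≡ 3 * (y + 6) + 3 * z
3*[y+z+1]+15 = solve-∀

9*[5+k] : ∀ k → 9 * (5 + k) + (1 + 2 * k + k * k) ≡ ((5 + k) * (5 + k) + (5 + k) + 1) + 15
9*[5+k] = solve-∀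

2*p+3 : ∀ p → 2 * p + 3 ≡ p + 3 + p
2*p+3 = solve-∀

3*[z+z]+3*z : ∀ z → 3 * (z + z) + 3 * z ≡ 9 * z
3*[z+z]+3*z = solve-∀

-- Excludes p = Φ a, for which `root-of-Φ-value` would give 2 p ≤ y. From 2 p ≤ y follow y + 6 ≤ 2 z
-- and Φ z + 15 ≤ 9 z, whereas Φ z + 15 - 9 z = (z - 4)² > 0.
third-image-cofactor-large : ∀ {y z p r} → 5 ≤ z → y + z + 1 ≡ r → Φ z ≡ 3 * r → p + z ≡ y + 3 → ¬ (2 * p ≤ y)
third-image-cofactor-large {y} {z} {p} {r} 5≤z refl ez pz 2p≤y = <-irrefl refl (begin-strict
  9 * z                   <⟨ 9z<Φz+15 5≤z ⟩
  Φ z + 15                ≡⟨ cong (_+ 15) ez ⟩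
  3 * (y + z + 1) + 15    ≡⟨ 3*[y+z+1]+15 y z ⟩
  3 * (y + 6) + 3 * z     ≤⟨ +-monoˡ-≤ (3 * z) (*-monoʳ-≤ 3 y+6≤2z) ⟩
  3 * (z + z) + 3 * z     ≡⟨ 3*[z+z]+3*z z ⟩
  9 * z                   ∎)
  where
  open ≤-Reasoning
  9z<Φz+15 : ∀ {z} → 5 ≤ z → 9 * z < Φ z + 15
  9z<Φz+15 5≤z with k , refl ← m≤n⇒∃[o]m+o≡n 5≤z = subst (9 * (5 + k) <_) (9*[5+k] k) (m<m+n _ z<s)
  p+3≤z : p + 3 ≤ z
  p+3≤z = +-cancelʳ-≤ p _ _ (begin
    p + 3 + p  ≡⟨ 2*p+3 p ⟨
    2 * p + 3  ≤⟨ +-monoˡ-≤ 3 2p≤y ⟩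
    y + 3      ≡⟨ pz ⟨
    p + z      ≡⟨ +-comm p z ⟩
    z + p      ∎)
  y+6≤2z : y + 6 ≤ z + z
  y+6≤2z = begin
    y + 6        ≡⟨ +-assoc y 3 3 ⟨
    y + 3 + 3    ≡⟨ cong (_+ 3) pz ⟨
    p + z + 3    ≡⟨ trans (+-assoc p z 3) (trans (cong (p +_) (+-comm z 3)) (sym (+-assoc p 3 z))) ⟩
    p + 3 + z    ≤⟨ +-monoˡ-≤ z p+3≤z ⟩
    z + z        ∎

3*[p+t+3+t+1] : ∀ p t → 3 * (p + t + (3 + t) + 1) ≡ 3 * p + (6 * t + 12)
3*[p+t+3+t+1] = solve-∀

Φ[3+t] : ∀ t → (3 + t) * (3 + t) + (3 + t) + 1 ≡ t * t + t + 1 + (6 * t + 12)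
Φ[3+t] = solve-∀

p+[3+t] : ∀ p t → p + (3 + t) ≡ p + t + 3
p+[3+t] = solve-∀

-- Eliminating y and r leaves 3 p = Φ (z - 3). So x would be z - 3, which has the opposite parity to
-- z.
third-image-cofactor-not-third-image : ∀ {y z p r x} → 5 ≤ z → Odd z → Odd x →
  y + z + 1 ≡ r → Φ z ≡ 3 * r → p + z ≡ y + 3 → Φ x ≢ 3 * p
third-image-cofactor-not-third-image {y} {z} {p} {r} {x} 5≤z zo xo refl ez pz ex
  with t , refl ← m≤n⇒∃[o]m+o≡n (≤-trans (s≤s (s≤s (s≤s z≤n))) 5≤z)
  with refl ← +-cancelʳ-≡ 3 _ _ (trans (sym (p+[3+t] p t)) pz)
  with refl ← Φ-injective {x} {t} (trans ex (+-cancelʳ-≡ (6 * t + 12) _ _ (trans (sym (3*[p+t+3+t+1] p t)) (trans (sym ez) (Φ[3+t] t)))))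
  with k , refl ← odd⇒1+2k xo = zo (divides (2 + k) refl)

-- Sums over lists

∑ : (ℕ → ℕ) → List ℕ → ℕ
∑ f xs = sum (map f xs)

∑-mono-≤ : ∀ {f g} xs → (∀ {x} → x ∈ xs → f x ≤ g x) → ∑ f xs ≤ ∑ g xs
∑-mono-≤ [] _ = z≤n
∑-mono-≤ (x ∷ xs) h = +-mono-≤ (h (here refl)) (∑-mono-≤ xs (h ∘ there))

interchange : ∀ a b c d → a + b + (c + d) ≡ a + c + (b + d)
interchange = solve-∀

∑-+ : ∀ (f g : ℕ → ℕ) xs → ∑ (λ x → f x + g x) xs ≡ ∑ f xs + ∑ g xs
∑-+ f g [] = refl
∑-+ f g (x ∷ xs) = trans (cong (f x + g x +_) (∑-+ f g xs)) (interchange (f x) (g x) (∑ f xs) (∑ g xs))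

∑-0 : ∀ xs → ∑ (λ _ → 0) xs ≡ 0
∑-0 [] = refl
∑-0 (x ∷ xs) = ∑-0 xs

∑-swap : ∀ (h : ℕ → ℕ → ℕ) xs ys → ∑ (λ x → ∑ (h x) ys) xs ≡ ∑ (λ y → ∑ (λ x → h x y) xs) ys
∑-swap h [] ys = sym (∑-0 ys)
∑-swap h (x ∷ xs) ys = trans (cong (∑ (h x) ys +_) (∑-swap h xs ys)) (sym (∑-+ (h x) (λ y → ∑ (λ x → h x y) xs) ys))

∑-* : ∀ k f xs → ∑ (λ x → k * f x) xs ≡ k * ∑ f xs
∑-* k f [] = sym (*-zeroʳ k)
∑-* k f (x ∷ xs) = trans (cong (k * f x +_) (∑-* k f xs)) (sym (*-distribˡ-+ k (f x) (∑ f xs)))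

∑-const : ∀ k xs → ∑ (λ _ → k) xs ≡ k * length xs
∑-const k [] = sym (*-zeroʳ k)
∑-const k (x ∷ xs) = trans (cong (k +_) (∑-const k xs)) (sym (*-suc k (length xs)))

∑-++ : ∀ f xs ys → ∑ f (xs ++ ys) ≡ ∑ f xs + ∑ f ys
∑-++ f xs ys = trans (cong sum (map-++ f xs ys)) (sum-++ (map f xs) (map f ys))

term≤∑ : ∀ f {x xs} → x ∈ xs → f x ≤ ∑ f xs
term≤∑ f {xs = _ ∷ xs} (here refl) = m≤m+n _ (∑ f xs)
term≤∑ f {xs = y ∷ xs} (there x∈) = ≤-trans (term≤∑ f x∈) (m≤n+m _ (f y))

when : ∀ {a} {A : Set a} → Dec A → ℕ → ℕ
when d k = if does d then k else 0

when-yes : ∀ {a} {A : Set a} (d : Dec A) {k} → A → when d k ≡ k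
when-yes (yes _) _ = refl
when-yes (no ¬a) a = ⊥-elim (¬a a)

when-no : ∀ {a} {A : Set a} (d : Dec A) {k} → ¬ A → when d k ≡ 0
when-no (yes a) ¬a = ⊥-elim (¬a a)
when-no (no _) _ = refl

when≤ : ∀ {a} {A : Set a} (d : Dec A) k → when d k ≤ k
when≤ (yes _) k = ≤-refl
when≤ (no _) k = z≤n

∑-filter : ∀ {p} {P : Pred ℕ p} (P? : Decidable P) f xs → ∑ f (filter P? xs) ≡ ∑ (λ x → when (P? x) (f x)) xs
∑-filter P? f [] = refl
∑-filter P? f (x ∷ xs) with P? x
... | yes _ = cong (f x +_) (∑-filter P? f xs)
... | no _ = ∑-filter P? f xs

∑-none : ∀ {p} {P : Pred ℕ p} (P? : Decidable P) k xs → All (¬_ ∘ P) xs → ∑ (λ x → when (P? x) k) xs ≡ 0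
∑-none P? k [] _ = refl
∑-none P? k (x ∷ xs) (¬p ∷ ¬ps) = cong₂ _+_ (when-no (P? x) ¬p) (∑-none P? k xs ¬ps)

∑-at-most-one : ∀ {p} {P : Pred ℕ p} (P? : Decidable P) k {xs} → Unique xs →
                (∀ {x y} → x ∈ xs → y ∈ xs → P x → P y → x ≡ y) → ∑ (λ x → when (P? x) k) xs ≤ k
∑-at-most-one P? k [] _ = z≤n
∑-at-most-one P? k {x ∷ xs} (x∉ ∷ u) h with P? x
... | no _ = ∑-at-most-one P? k u (λ i j → h (there i) (there j))
... | yes p = ≤-reflexive (trans (cong (k +_) (∑-none P? k xs (All.tabulate λ y∈ py → All.lookup x∉ y∈ (h (here refl) (there y∈) p py)))) (+-identityʳ k))

count : ℕ → List ℕ → ℕ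
count p = ∑ (λ r → when (p ≟ r) 1)

^count∣product : ∀ p rs → p ^ count p rs ∣ product rs
^count∣product p [] = ∣-refl
^count∣product p (r ∷ rs) = step (p ≟ r)
  where
  step : (d : Dec (p ≡ r)) → p ^ (when d 1 + count p rs) ∣ r * product rs
  step (yes refl) = *-monoʳ-∣ p (^count∣product p rs)
  step (no _) = ∣n⇒∣m*n r (^count∣product p rs)

∑≤∑-count : ∀ w {ps} rs → (∀ {r} → r ∈ rs → r ∈ ps) → ∑ w rs ≤ ∑ (λ p → count p rs * w p) ps
∑≤∑-count w [] _ = z≤n
∑≤∑-count w {ps} (r ∷ rs) h = begin
  w r + ∑ w rs
    ≤⟨ +-mono-≤ (≤-trans (≤-reflexive (sym (trans (cong (_* w r) (when-yes (r ≟ r) refl)) (*-identityˡ (w r))))) (term≤∑ (λ p → when (p ≟ r) 1 * w p) (h (here refl)))) (∑≤∑-count w rs (h ∘ there)) ⟩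
  ∑ (λ p → when (p ≟ r) 1 * w p) ps + ∑ (λ p → count p rs * w p) ps
    ≡⟨ ∑-+ (λ p → when (p ≟ r) 1 * w p) (λ p → count p rs * w p) ps ⟨
  ∑ (λ p → when (p ≟ r) 1 * w p + count p rs * w p) ps
    ≡⟨ cong sum (map-cong (λ p → *-distribʳ-+ (w p) (when (p ≟ r) 1) (count p rs)) ps) ⟨
  ∑ (λ p → count p (r ∷ rs) * w p) ps ∎
  where open ≤-Reasoning

-- Divisor sums and valuations

same-elements⇒↭ : ∀ {xs ys : List ℕ} → Unique xs → Unique ys →
                  (∀ {z} → z ∈ xs → z ∈ ys) → (∀ {z} → z ∈ ys → z ∈ xs) → xs ↭ ys
same-elements⇒↭ ux uy f g = ∼bag⇒↭ (unique∧set⇒bag ux uy (mk⇔ f g))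

range1-unique : ∀ n → Unique (range1 n)
range1-unique n = Unique.map⁺ suc-injective (Unique.upTo⁺ n)

∈-range1⁺ : ∀ {k n} → 0 < k → k ≤ n → k ∈ range1 n
∈-range1⁺ {suc k} _ k<n = ∈-map⁺ suc (∈-upTo⁺ k<n)

∈-range1⁻ : ∀ {k n} → k ∈ range1 n → 0 < k × k ≤ n
∈-range1⁻ k∈ with ∈-map⁻ suc k∈
... | _ , j∈ , refl = z<s , ∈-upTo⁻ j∈

divisors-unique : ∀ n → Unique (divisors n)
divisors-unique n = Unique.filter⁺ (_∣? n) (range1-unique n)

∈-divisors⁺ : ∀ {d n} → .⦃ NonZero n ⦄ → d ∣ n → d ∈ divisors n
∈-divisors⁺ {zero} {n} d∣n = ⊥-elim (≢-nonZero⁻¹ n (0∣⇒≡0 d∣n))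
∈-divisors⁺ {suc _} {n} d∣n = ∈-filter⁺ (_∣? n) (∈-range1⁺ z<s (∣⇒≤ d∣n)) d∣n

∈-divisors⁻ : ∀ {d n} → d ∈ divisors n → d ∣ n
∈-divisors⁻ {n = n} = proj₂ ∘ ∈-filter⁻ (_∣? n) {xs = range1 n}

∤⇒coprime : ∀ {p d} → Prime p → p ∤ d → Coprime d p
∤⇒coprime pp p∤d (i∣d , i∣p) with prime⇒irreducible pp i∣p
... | inj₁ i≡1 = i≡1
... | inj₂ refl = ⊥-elim (p∤d i∣d)

module _ {p} (pp : Prime p) where
  private instance
    p≢0 : NonZero p
    p≢0 = prime⇒nonZero pp

  ∤∧∣^*⇒∣ : ∀ {d} k {m} → p ∤ d → d ∣ p ^ k * m → d ∣ m
  ∤∧∣^*⇒∣ {d} zero {m} _ h = subst (d ∣_) (+-identityʳ m) h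
  ∤∧∣^*⇒∣ {d} (suc k) {m} p∤d h = ∤∧∣^*⇒∣ k p∤d (coprime-divisor (∤⇒coprime pp p∤d) (subst (d ∣_) (*-assoc p (p ^ k) m) h))

  -- Divisors prime to p are those of m; all others are p times a divisor of p^k m. Summing gives
  -- the recursion behind `σ-p^k*m`.
  divisors-p^[1+k]*m : ∀ k m → .⦃ NonZero m ⦄ → p ∤ m →
    divisors (p * (p ^ k * m)) ↭ divisors m ++ map (p *_) (divisors (p ^ k * m))
  divisors-p^[1+k]*m k m p∤m = same-elements⇒↭ (divisors-unique n)
    (Unique.++⁺ (divisors-unique m) (Unique.map⁺ (*-cancelˡ-≡ _ _ p) (divisors-unique (p ^ k * m)))
      λ (d∈ , d∈′) → disjoint (∈-divisors⁻ d∈) (∈-map⁻ (p *_) d∈′))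
    to from
    where
    n = p * (p ^ k * m)
    instance
      p^k*m≢0 : NonZero (p ^ k * m)
      p^k*m≢0 = m*n≢0 (p ^ k) m ⦃ m^n≢0 p k ⦄
      n≢0 : NonZero n
      n≢0 = m*n≢0 p (p ^ k * m)
    disjoint : ∀ {d} → d ∣ m → (∃ λ e → e ∈ divisors (p ^ k * m) × d ≡ p * e) → ⊥
    disjoint d∣m (e , _ , refl) = p∤m (m*n∣⇒m∣ p e d∣m)
    to : ∀ {d} → d ∈ divisors n → d ∈ divisors m ++ map (p *_) (divisors (p ^ k * m))
    to {d} d∈ with p ∣? d
    ... | no p∤d = ∈-++⁺ˡ (∈-divisors⁺ (∤∧∣^*⇒∣ (suc k) p∤d (subst (d ∣_) (sym (*-assoc p (p ^ k) m)) (∈-divisors⁻ d∈))))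
    ... | yes (divides e refl) = ∈-++⁺ʳ (divisors m) (subst (_∈ map (p *_) (divisors (p ^ k * m))) (*-comm p e)
            (∈-map⁺ (p *_) (∈-divisors⁺ (*-cancelˡ-∣ p (subst (_∣ n) (*-comm e p) (∈-divisors⁻ d∈))))))
    from : ∀ {d} → d ∈ divisors m ++ map (p *_) (divisors (p ^ k * m)) → d ∈ divisors n
    from d∈ with ∈-++⁻ (divisors m) d∈
    ... | inj₁ d∈ₗ = ∈-divisors⁺ (∣n⇒∣m*n p (∣n⇒∣m*n (p ^ k) (∈-divisors⁻ d∈ₗ)))
    ... | inj₂ d∈ᵣ with e , e∈ , refl ← ∈-map⁻ (p *_) d∈ᵣ = ∈-divisors⁺ (*-monoʳ-∣ p (∈-divisors⁻ e∈))

  geometric : ℕ → ℕ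
  geometric zero = 1
  geometric (suc k) = 1 + p * geometric k

  σ-p^k*m : ∀ k m → .⦃ NonZero m ⦄ → p ∤ m → σ (p ^ k * m) ≡ geometric k * σ m
  σ-p^k*m zero m _ = trans (cong σ (+-identityʳ m)) (sym (+-identityʳ (σ m)))
  σ-p^k*m (suc k) m p∤m = begin
    σ (p * p ^ k * m)                                      ≡⟨ cong σ (*-assoc p (p ^ k) m) ⟩
    σ (p * (p ^ k * m))                                    ≡⟨ sum-↭ (divisors-p^[1+k]*m k m p∤m) ⟩
    sum (divisors m ++ map (p *_) (divisors (p ^ k * m)))  ≡⟨ sum-++ (divisors m) _ ⟩
    σ m + ∑ (p *_) (divisors (p ^ k * m))                  ≡⟨ cong (σ m +_) (∑-* p (λ d → d) (divisors (p ^ k * m))) ⟩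
    σ m + p * ∑ (λ d → d) (divisors (p ^ k * m))           ≡⟨ cong (λ ds → σ m + p * sum ds) (map-id (divisors (p ^ k * m))) ⟩
    σ m + p * σ (p ^ k * m)                                ≡⟨ cong (λ s → σ m + p * s) (σ-p^k*m k m p∤m) ⟩
    σ m + p * (geometric k * σ m)                          ≡⟨ cong (σ m +_) (*-assoc p (geometric k) (σ m)) ⟨
    geometric (suc k) * σ m ∎
    where open ≡-Reasoning

  ^∣^*⇒≤ : ∀ {i} j {m} → p ∤ m → p ^ i ∣ p ^ j * m → i ≤ j
  ^∣^*⇒≤ {zero} j _ _ = z≤n
  ^∣^*⇒≤ {suc i} zero {m} p∤m h = ⊥-elim (p∤m (m*n∣⇒m∣ p (p ^ i) (subst (p ^ suc i ∣_) (+-identityʳ m) h)))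
  ^∣^*⇒≤ {suc i} (suc j) {m} p∤m h = s≤s (^∣^*⇒≤ j p∤m (*-cancelˡ-∣ p (subst (p ^ suc i ∣_) (*-assoc p (p ^ j) m) h)))

  ^-monoʳ-∣ : ∀ {i j} → i ≤ j → p ^ i ∣ p ^ j
  ^-monoʳ-∣ {i} i≤j with k , refl ← m≤n⇒∃[o]m+o≡n i≤j = subst (p ^ i ∣_) (sym (^-distribˡ-+-* p i k)) (m∣m*n (p ^ k))

  k≤p^k : ∀ k → k ≤ p ^ k
  k≤p^k zero = z≤n
  k≤p^k (suc k) = ≤-trans (s≤s (k≤p^k k)) (m<p*m (p ^ k) ⦃ m^n≢0 p k ⦄)
    where
    m<p*m : ∀ m → .⦃ NonZero m ⦄ → m < p * m
    m<p*m m = subst (m <_) (*-comm m p) (m<m*n m p (nonTrivial⇒n>1 p ⦃ prime⇒nonTrivial pp ⦄))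

  valuation-p^j*m : ∀ j m → .⦃ NonZero m ⦄ → p ∤ m → valuation p (p ^ j * m) ≡ j
  valuation-p^j*m j m p∤m = trans (↭-length same) (trans (length-map suc (upTo j)) (length-upTo j))
    where
    n = p ^ j * m
    same : filter (λ k → p ^ k ∣? n) (range1 n) ↭ range1 j
    same = same-elements⇒↭ (Unique.filter⁺ (λ k → p ^ k ∣? n) (range1-unique n)) (range1-unique j)
      (λ k∈ → let k∈n , p^k∣n = ∈-filter⁻ (λ k → p ^ k ∣? n) {xs = range1 n} k∈ in
              ∈-range1⁺ (proj₁ (∈-range1⁻ {n = n} k∈n)) (^∣^*⇒≤ j p∤m p^k∣n))
      (λ k∈ → let 0<k , k≤j = ∈-range1⁻ k∈ in
              ∈-filter⁺ (λ k → p ^ k ∣? n)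
                -- `valuation` only tries exponents up to n; j ≤ p^j ≤ n keeps the relevant ones in
                -- range.
                (∈-range1⁺ 0<k (≤-trans k≤j (≤-trans (k≤p^k j) (m≤m*n (p ^ j) m))))
                (∣m⇒∣m*n m (^-monoʳ-∣ k≤j)))

  Decomposition : ℕ → Set
  Decomposition n = ∃ λ j → ∃ λ m → n ≡ p ^ j * m × p ∤ m × NonZero m

  decompose : ∀ n → .⦃ NonZero n ⦄ → Decomposition n
  decompose n = <-rec (λ n → n ≢ 0 → Decomposition n) step n (≢-nonZero⁻¹ n)
    where
    step : ∀ n → (∀ {m} → m < n → m ≢ 0 → Decomposition m) → n ≢ 0 → Decomposition n
    step n rec n≢0 with p ∣? n
    ... | no p∤n = 0 , n , sym (+-identityʳ n) , p∤n , ≢-nonZero n≢0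
    ... | yes (divides q refl) with q ≟ 0
    ...   | yes refl = ⊥-elim (n≢0 refl)
    ...   | no q≢0 with rec (m<m*n q p ⦃ ≢-nonZero q≢0 ⦄ (nonTrivial⇒n>1 p ⦃ prime⇒nonTrivial pp ⦄)) q≢0
    ...     | j , m , e , p∤m , nz = suc j , m , trans (*-comm q p) (trans (cong (p *_) e) (sym (*-assoc p (p ^ j) m))) , p∤m , nz

  decompose-valuation : ∀ n → .⦃ NonZero n ⦄ → ∃ λ m → n ≡ p ^ valuation p n * m × p ∤ m × NonZero m
  decompose-valuation n with j , m , e , p∤m , nz ← decompose n =
    m , subst (λ i → n ≡ p ^ i * m) (sym (trans (cong (valuation p) e) (valuation-p^j*m j m ⦃ nz ⦄ p∤m))) e , p∤m , nz

primeDivisors-unique : ∀ n → Unique (primeDivisors n)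
primeDivisors-unique n = Unique.filter⁺ prime? (divisors-unique n)

∈-primeDivisors⁺ : ∀ {p n} → .⦃ NonZero n ⦄ → Prime p → p ∣ n → p ∈ primeDivisors n
∈-primeDivisors⁺ pp p∣n = ∈-filter⁺ prime? (∈-divisors⁺ p∣n) pp

∈-primeDivisors⁻ : ∀ {p n} → p ∈ primeDivisors n → Prime p × p ∣ n
∈-primeDivisors⁻ {n = n} p∈ with d∈ , pp ← ∈-filter⁻ prime? {xs = divisors n} p∈ = pp , ∈-divisors⁻ d∈

prime∤prime : ∀ {p q} → Prime p → Prime q → p ≢ q → p ∤ q
prime∤prime pp pq p≢q p∣q with prime⇒irreducible pq p∣q
... | inj₁ refl = ¬prime[1] pp
... | inj₂ p≡q = p≢q p≡q

valuation-^* : ∀ {p q} → Prime p → Prime q → p ≢ q → ∀ k m → .⦃ NonZero m ⦄ →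
               valuation p (q ^ k * m) ≡ valuation p m
valuation-^* {p} {q} pp pq p≢q k m with j , m′ , refl , p∤m′ , nz ← decompose pp m =
  trans (cong (valuation p) (swap (q ^ k) (p ^ j) m′))
    (trans (valuation-p^j*m pp j (q ^ k * m′) ⦃ m*n≢0 (q ^ k) m′ ⦃ m^n≢0 q k ⦃ prime⇒nonZero pq ⦄ ⦄ ⦃ nz ⦄ ⦄
        (p∤m′ ∘ ∤∧∣^*⇒∣ pq k (prime∤prime pq pp (p≢q ∘ sym))))
      (sym (valuation-p^j*m pp j m′ ⦃ nz ⦄ p∤m′)))
  where
  swap : ∀ a b c → a * (b * c) ≡ b * (a * c)
  swap a b c = trans (sym (*-assoc a b c)) (trans (cong (_* c) (*-comm a b)) (*-assoc b a c))

geometric-2 : ∀ p → 1 + p * (1 + p * 1) ≡ p * p + p + 1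
geometric-2 = solve-∀

-- Removing x² from n splits Φ x = σ(x²) off σ(n) and leaves the exponents of the other primes
-- unchanged.
∏Φ∣σ : ∀ xs n → .⦃ NonZero n ⦄ → Unique xs → (∀ {x} → x ∈ xs → Prime x × valuation x n ≡ 2) →
       product (map Φ xs) ∣ σ n
∏Φ∣σ [] n _ _ = 1∣ σ n
∏Φ∣σ (x ∷ xs) n (x∉ ∷ u) h = step (decompose-valuation px n)
  where
  px = proj₁ (h (here refl))
  step : (∃ λ m → n ≡ x ^ valuation x n * m × x ∤ m × NonZero m) → Φ x * product (map Φ xs) ∣ σ n
  step (m , e , x∤m , nz) = subst (Φ x * product (map Φ xs) ∣_)
      (sym (trans (cong σ n≡x²m) (trans (σ-p^k*m px 2 m ⦃ nz ⦄ x∤m) (cong (_* σ m) (geometric-2 x)))))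
      (*-monoʳ-∣ (Φ x) (∏Φ∣σ xs m ⦃ nz ⦄ u rest))
    where
    n≡x²m : n ≡ x ^ 2 * m
    n≡x²m = trans e (cong (λ k → x ^ k * m) (proj₂ (h (here refl))))
    rest : ∀ {y} → y ∈ xs → Prime y × valuation y m ≡ 2
    rest {y} y∈ with py , v ← h (there y∈) =
      py , trans (sym (valuation-^* py px (λ y≡x → All.lookup x∉ y∈ (sym y≡x)) 2 m ⦃ nz ⦄)) (trans (cong (valuation y) (sym n≡x²m)) v)

odd-geometric-step : ∀ k g → 1 + (1 + k * 2) * (1 + (1 + k * 2) * g) ≡ (1 + k) * 2 + (1 + k * 2) * (1 + k * 2) * g
odd-geometric-step = solve-∀

2∣geometric : ∀ {p} (pp : Prime p) → Odd p → ∀ i → 2 ∣ geometric pp (1 + i * 2)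
2∣geometric {p} pp op i with k , refl ← odd⇒1+2k op = go i
  where
  go : ∀ i → 2 ∣ geometric pp (1 + i * 2)
  go zero = divides (1 + k) (cong (2 +_) (*-identityʳ (k * 2)))
  go (suc i) = subst (2 ∣_) (sym (odd-geometric-step k (geometric pp (1 + i * 2))))
    (∣m∣n⇒∣m+n (n∣m*n (1 + k)) (∣n⇒∣m*n ((1 + k * 2) * (1 + k * 2)) (go i)))

odd⇒nonZero : ∀ {n} → Odd n → NonZero n
odd⇒nonZero o = ≢-nonZero λ { refl → o (2 ∣0) }

valuation>0 : ∀ {p n} → .⦃ NonZero n ⦄ → p ∈ primeDivisors n → 0 < valuation p n
valuation>0 {p} {n} p∈ with pp , p∣n ← ∈-primeDivisors⁻ {n = n} p∈ with valuation p n | decompose-valuation pp n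
... | suc _ | _ = z<s
... | zero | m , e , p∤m , _ = ⊥-elim (p∤m (subst (p ∣_) (trans e (+-identityʳ m)) p∣n))

odd? : ∀ n → Dec (Odd n)
odd? n = ¬? (2 ∣? n)

-- Consequences of σ(N) = 2 N

module _ {N} (oN : Odd N) (perfect : Perfect N) where

  -- Two odd exponents would each contribute a factor 2 to σ N = 2 N.
  odd-valuation-unique : ∀ {p q} → Prime p → p ∣ N → Prime q → q ∣ N →
    Odd (valuation p N) → Odd (valuation q N) → p ≡ q
  odd-valuation-unique {p} {q} pp p∣N pq q∣N op oq with p ≟ q
  ... | yes p≡q = p≡q
  ... | no p≢q with m , e , p∤m , nz ← decompose-valuation pp N ⦃ odd⇒nonZero oN ⦄
    with m′ , e′ , q∤m′ , nz′ ← decompose-valuation pq m ⦃ nz ⦄ =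
    ⊥-elim (oN (*-cancelˡ-∣ 2 (subst (4 ∣_) (trans (sym σN) perfect)
      (*-pres-∣ (even pp p∣N op) (∣m⇒∣m*n (σ m′) (even pq q∣N (subst Odd vq oq)))))))
    where
    vq : valuation q N ≡ valuation q m
    vq = trans (cong (valuation q) e) (valuation-^* pq pp (p≢q ∘ sym) (valuation p N) m ⦃ nz ⦄)
    σN : σ N ≡ geometric pp (valuation p N) * (geometric pq (valuation q m) * σ m′)
    σN = trans (cong σ e) (trans (σ-p^k*m pp (valuation p N) m ⦃ nz ⦄ p∤m)
      (cong (geometric pp (valuation p N) *_) (trans (cong σ e′) (σ-p^k*m pq (valuation q m) m′ ⦃ nz′ ⦄ q∤m′))))
    even : ∀ {r} (pr : Prime r) → r ∣ N → ∀ {k} → Odd k → 2 ∣ geometric pr k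
    even pr r∣N {k} ok with i , refl ← odd⇒1+2k ok = 2∣geometric pr (λ 2∣r → oN (∣-trans 2∣r r∣N)) i

  -- Every `Φ x` is odd, so the factor 2 of σ(N) = 2 N can be removed.
  ∏Φ∣N : ∀ xs → Unique xs → (∀ {x} → x ∈ xs → Prime x × valuation x N ≡ 2) → product (map Φ xs) ∣ N
  ∏Φ∣N xs u h = ∤∧∣^*⇒∣ prime[2] 1 (∏Φ-odd xs) (subst (product (map Φ xs) ∣_) perfect (∏Φ∣σ xs N ⦃ odd⇒nonZero oN ⦄ u h))
    where
    ∏Φ-odd : ∀ xs → Odd (product (map Φ xs))
    ∏Φ-odd [] 2∣1 with () ← ∣1⇒≡1 2∣1
    ∏Φ-odd (x ∷ xs) 2∣∏ with euclidsLemma (Φ x) (product (map Φ xs)) prime[2] 2∣∏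
    ... | inj₁ 2∣Φ = Φ-odd x 2∣Φ
    ... | inj₂ 2∣∏′ = ∏Φ-odd xs 2∣∏′

  -- The slot count: a prime pays its weight at most as often as its exponent in N.
  count≤valuation : ∀ {p} rs → Prime p → product rs ∣ N → count p rs ≤ valuation p N
  count≤valuation {p} rs pp ∏∣N with m , e , p∤m , _ ← decompose-valuation pp N ⦃ odd⇒nonZero oN ⦄ =
    ^∣^*⇒≤ pp (valuation p N) p∤m (subst (p ^ count p rs ∣_) e (∣-trans (^count∣product p rs) ∏∣N))

  ∑-odd-valuations : ∀ k → ∑ (λ p → when (odd? (valuation p N)) k) (primeDivisors N) ≤ k
  ∑-odd-valuations k = ∑-at-most-one (λ p → odd? (valuation p N)) k (primeDivisors-unique N)
    λ x∈ y∈ → odd-valuation-unique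
      (proj₁ (∈-primeDivisors⁻ {n = N} x∈)) (proj₂ (∈-primeDivisors⁻ {n = N} x∈))
      (proj₁ (∈-primeDivisors⁻ {n = N} y∈)) (proj₂ (∈-primeDivisors⁻ {n = N} y∈))

-- Distributing the prime factors of N

odd-prime≥3 : ∀ {x} → Prime x → Odd x → 3 ≤ x
odd-prime≥3 {0} px _ = ⊥-elim (¬prime[0] px)
odd-prime≥3 {1} px _ = ⊥-elim (¬prime[1] px)
odd-prime≥3 {2} _ ox = ⊥-elim (ox ∣-refl)
odd-prime≥3 {suc (suc (suc x))} _ _ = s≤s (s≤s (s≤s z≤n))

odd-prime≡1⇒≥5 : ∀ {x} → Prime x → Odd x → x % 3 ≡ 1 → 5 ≤ x
odd-prime≡1⇒≥5 {0} px _ _ = ⊥-elim (¬prime[0] px)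
odd-prime≡1⇒≥5 {1} px _ _ = ⊥-elim (¬prime[1] px)
odd-prime≡1⇒≥5 {2} _ _ ()
odd-prime≡1⇒≥5 {3} _ _ ()
odd-prime≡1⇒≥5 {4} _ ox _ = ⊥-elim (ox (divides 2 refl))
odd-prime≡1⇒≥5 {suc (suc (suc (suc (suc x))))} _ _ _ = s≤s (s≤s (s≤s (s≤s (s≤s z≤n))))

x<Φx : ∀ x → x < Φ x
x<Φx x = subst (_≤ Φ x) (+-comm x 1) (+-monoˡ-≤ 1 (m≤n+m x (x * x)))

Φ-nonZero : ∀ x → NonZero (Φ x)
Φ-nonZero x = >-nonZero (≤-<-trans z≤n (x<Φx x))

prime[3] : Prime 3
prime[3] = from-yes (prime? 3)

B₃-middle : ∀ u v → v + (u + u) ≡ u + (v + u)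
B₃-middle = solve-∀

B₃-last : ∀ u v → v + (u + u) ≡ u + (u + v)
B₃-last = solve-∀

-- With S = { x : x² ∥ N }, an x ∈ S demands dB if x ≡ 2 and dA if x ≡ 1 (mod 3). Each prime
-- factor r of Φ x pays x a weight: t if r = 3, u if r = Φ a for some a ∈ S with a ≡ 2 (kind U),
-- otherwise v if 3 r = Φ a for some a ∈ S with a ≡ 1 (kind V), and z if neither (kind free).
-- In addition r pays b, l′ or l, according to its kind U, V or free, to the x ≡ 2 with r ∣ Φ x
-- and x < r, and c to the x ≡ 1 with Φ x = 3 r. The constraints Bₙ and Aₙ say that this meets the
-- demand when Φ x has n prime factors other than 3 (at least n for B₄ and A₃).
record Weights : Set where
  field
    u v z t b l l′ c dB dA : ℕ
    u≤v : u ≤ v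
    v≤z : v ≤ z
    B₁  : dB ≤ u + b
    B₂  : dB ≤ u + z + l
    B₂′ : dB ≤ z + v + l′
    B₃  : dB ≤ v + (u + u)
    B₄  : dB ≤ u + (u + (u + u))
    A₁  : dA ≤ t + v + c
    A₂  : dA ≤ t + (u + v)
    A₃  : dA ≤ t + (u + (u + u))

data Kind : Set where
  three none U V free : Kind

module Charging {N} (oN : Odd N) (perfect : Perfect N) (W : Weights) where
  open Weights W
  private instance
    N≢0 : NonZero N
    N≢0 = odd⇒nonZero oN

  P S : List ℕ
  P = primeDivisors N
  S = filter (λ p → valuation p N ≟ 2) P

  S-prime : ∀ {x} → x ∈ S → Prime x
  S-prime x∈ = proj₁ (∈-primeDivisors⁻ {n = N} (proj₁ (∈-filter⁻ (λ p → valuation p N ≟ 2) {xs = P} x∈)))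

  S-valuation : ∀ {x} → x ∈ S → valuation x N ≡ 2
  S-valuation x∈ = proj₂ (∈-filter⁻ (λ p → valuation p N ≟ 2) {xs = P} x∈)

  divisor-odd : ∀ {d} → d ∣ N → Odd d
  divisor-odd d∣N 2∣d = oN (∣-trans 2∣d d∣N)

  S-odd : ∀ {x} → x ∈ S → Odd x
  S-odd x∈ = divisor-odd (proj₂ (∈-primeDivisors⁻ {n = N} (proj₁ (∈-filter⁻ (λ p → valuation p N ≟ 2) {xs = P} x∈))))

  S-unique : Unique S
  S-unique = Unique.filter⁺ (λ p → valuation p N ≟ 2) (primeDivisors-unique N)

  BImage AImage : ℕ → ℕ → Set
  BImage r x = x % 3 ≡ 2 × Φ x ≡ r
  AImage r x = x % 3 ≡ 1 × Φ x ≡ 3 * r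

  B-image? : ∀ r → Dec (Any (BImage r) S)
  B-image? r = any? (λ x → (x % 3 ≟ 2) ×-dec (Φ x ≟ r)) S

  A-image? : ∀ r → Dec (Any (AImage r) S)
  A-image? r = any? (λ x → (x % 3 ≟ 1) ×-dec (Φ x ≟ 3 * r)) S

  image-kind : ∀ {a b} {A : Set a} {B : Set b} → Dec A → Dec B → Kind
  image-kind (yes _) _ = U
  image-kind (no _) (yes _) = V
  image-kind (no _) (no _) = free

  -- A prime ≡ 2 (mod 3) divides no `Φ x`; its kind `none` therefore pays nothing.
  residue-kind : ℕ → Kind → Kind
  residue-kind 0 _ = three
  residue-kind 1 k = k
  residue-kind _ _ = none

  kind : ℕ → Kind
  kind r = residue-kind (r % 3) (image-kind (B-image? r) (A-image? r))

  -- Indexed by the kind, so that `kind r` can be generalised to a variable without losing the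
  -- evidence about images.
  data KindView (r : ℕ) : Kind → Set where
    isU : Any (BImage r) S → KindView r U
    isV : ¬ Any (BImage r) S → Any (AImage r) S → KindView r V
    isFree : ¬ Any (BImage r) S → ¬ Any (AImage r) S → KindView r free

  kind-view : ∀ {r} → r % 3 ≡ 1 → KindView r (kind r)
  kind-view {r} e = subst (KindView r) (cong (λ m → residue-kind m (image-kind (B-image? r) (A-image? r))) (sym e))
      (view (B-image? r) (A-image? r))
    where
    view : (d : Dec (Any (BImage r) S)) (d′ : Dec (Any (AImage r) S)) → KindView r (image-kind d d′)
    view (yes i) _ = isU i
    view (no ¬i) (yes j) = isV ¬i j
    view (no ¬i) (no ¬j) = isFree ¬i ¬j

  weight bonusB bonusA : Kind → ℕ
  weight three = t
  weight none = 0
  weight U = u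
  weight V = v
  weight free = z
  bonusB U = b
  bonusB V = l′
  bonusB free = l
  bonusB _ = 0
  bonusA V = c
  bonusA _ = 0

  w : ℕ → ℕ
  w r = weight (kind r)

  residue-demand : ℕ → ℕ
  residue-demand 1 = dA
  residue-demand 2 = dB
  residue-demand _ = 0

  demand : ℕ → ℕ
  demand x = residue-demand (x % 3)

  B-bonus? : ∀ x r → Dec (x % 3 ≡ 2 × r ∣ Φ x × x < r)
  B-bonus? x r = (x % 3 ≟ 2) ×-dec ((r ∣? Φ x) ×-dec (x <? r))

  A-bonus? : ∀ x r → Dec (x % 3 ≡ 1 × Φ x ≡ 3 * r)
  A-bonus? x r = (x % 3 ≟ 1) ×-dec (Φ x ≟ 3 * r)

  bonus : ℕ → ℕ → ℕ
  bonus x r = when (B-bonus? x r) (bonusB (kind r)) + when (A-bonus? x r) (bonusA (kind r))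

  income : ℕ → ℕ
  income r = bonusB (kind r) + bonusA (kind r)

  -- Each bonus of r has at most one recipient: the first by `≡2-root-unique`, the second because Φ
  -- x = 3 r determines x.
  ∑-bonus≤income : ∀ {r} → r ∈ P → ∑ (λ x → bonus x r) S ≤ income r
  ∑-bonus≤income {r} r∈ = ≤-trans
    (≤-reflexive (∑-+ (λ x → when (B-bonus? x r) (bonusB (kind r))) (λ x → when (A-bonus? x r) (bonusA (kind r))) S))
    (+-mono-≤
      (∑-at-most-one (λ x → B-bonus? x r) (bonusB (kind r)) S-unique
        λ { {x} {y} _ _ (ex , rx , x<r) (ey , ry , y<r) → ≡2-root-unique (proj₁ (∈-primeDivisors⁻ {n = N} r∈)) {i = x / 3} {j = y / 3} (%3⇒ x 2 ex) (%3⇒ y 2 ey) x<r y<r rx ry })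
      (∑-at-most-one (λ x → A-bonus? x r) (bonusA (kind r)) S-unique
        λ { _ _ (_ , e) (_ , e′) → Φ-injective (trans e (sym e′)) }))

  B-bonus≤ : ∀ {x r} → r ∈ P → x % 3 ≡ 2 → r ∣ Φ x → x < r → bonusB (kind r) ≤ ∑ (bonus x) P
  B-bonus≤ {x} {r} r∈ e r∣ x<r = ≤-trans (≤-reflexive (sym (when-yes (B-bonus? x r) (e , r∣ , x<r))))
    (≤-trans (m≤m+n _ _) (term≤∑ (bonus x) r∈))

  A-bonus≤ : ∀ {x r} → r ∈ P → x % 3 ≡ 1 → Φ x ≡ 3 * r → bonusA (kind r) ≤ ∑ (bonus x) P
  A-bonus≤ {x} {r} r∈ e e′ = ≤-trans (≤-reflexive (sym (when-yes (A-bonus? x r) (e , e′))))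
    (≤-trans (m≤n+m _ (when (B-bonus? x r) (bonusB (kind r)))) (term≤∑ (bonus x) r∈))

  Φ∣N : ∀ {x} → x ∈ S → Φ x ∣ N
  Φ∣N {x} x∈ = subst (_∣ N) (*-identityʳ (Φ x)) (∏Φ∣N oN perfect (x ∷ []) ([] ∷ []) λ { (here refl) → S-prime x∈ , S-valuation x∈ })

  factor∈P : ∀ {x r} → x ∈ S → Prime r → r ∣ Φ x → r ∈ P
  factor∈P x∈ pr r∣ = ∈-primeDivisors⁺ pr (∣-trans r∣ (Φ∣N x∈))

  -- 1 + m·3 will be `Φ x` for x ≡ 2 and Φ x / 3 for x ≡ 1. It excludes r = 3, and `≡2⇒∤Φ` excludes
  -- r ≡ 2.
  factor≡1 : ∀ x m {r} → Prime r → r ∣ Φ x → r ∣ 1 + m * 3 → r % 3 ≡ 1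
  factor≡1 x m {r} pr r∣Φ r∣m with %3-cases r
  ... | inj₂ (inj₁ e) = e
  ... | inj₂ (inj₂ e) = ⊥-elim (≡2⇒∤Φ r (r / 3) (%3⇒ r 2 e) x r∣Φ)
  ... | inj₁ e with divides q eq ← ∣-trans (divides (r / 3) (%3⇒ r 0 e)) r∣m
    with () ← residue-unique 1 0 m q eq

  u≤w : ∀ r → r % 3 ≡ 1 → u ≤ w r
  u≤w r e with kind r | kind-view {r} e
  ... | U | _ = ≤-refl
  ... | V | _ = u≤v
  ... | free | _ = ≤-trans u≤v v≤z

  U-or-v≤w : ∀ r → r % 3 ≡ 1 → (∃ λ a → a ∈ S × BImage r a) ⊎ v ≤ w r
  U-or-v≤w r e with kind r | kind-view {r} e
  ... | U | isU i = inj₁ (find i)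
  ... | V | _ = inj₂ ≤-refl
  ... | free | _ = inj₂ v≤z

  module B-element {x} (x∈ : x ∈ S) (x≡2 : x % 3 ≡ 2) where
    private
      px = S-prime x∈
      ox = S-odd x∈

    factor%3 : ∀ {r} → Prime r → r ∣ Φ x → r % 3 ≡ 1
    factor%3 {r} pr r∣ = factor≡1 x (2 + 5 * (x / 3) + 3 * (x / 3 * (x / 3))) pr r∣
      (subst (r ∣_) (trans (cong Φ (%3⇒ x 2 x≡2)) (Φ[2+k*3] (x / 3))) r∣)

    charge₁ : ∀ {r} → Prime r → Φ x ≡ r → dB ≤ w r + ∑ (bonus x) P
    charge₁ {r} pr e = ≤-trans B₁ (by-kind (kind r) (kind-view (factor%3 pr r∣)) (B-bonus≤ (factor∈P x∈ pr r∣) x≡2 r∣ (subst (x <_) e (x<Φx x))))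
      where
      r∣ : r ∣ Φ x
      r∣ = ∣-reflexive (sym e)
      by-kind : ∀ k → KindView r k → bonusB k ≤ ∑ (bonus x) P → u + b ≤ weight k + ∑ (bonus x) P
      by-kind U _ h = +-monoʳ-≤ u h
      by-kind V (isV ¬i _) _ = ⊥-elim (¬i (lose x∈ (x≡2 , e)))
      by-kind free (isFree ¬i _) _ = ⊥-elim (¬i (lose x∈ (x≡2 , e)))

    -- The larger factor r exceeds x and pays the bonus; it cannot be of kind U. If it is of kind V,
    -- then p must be free, and `B₂′` applies in place of `B₂`.
    charge₂ : ∀ {p r} → Prime p → Prime r → p ≤ r → Φ x ≡ p * r → dB ≤ w p + w r + ∑ (bonus x) P
    charge₂ {p} {r} pp pr p≤r e = by-kind (kind r) (kind-view (factor%3 pr r∣)) (B-bonus≤ (factor∈P x∈ pr r∣) x≡2 r∣ x<r)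
      where
      r∣ : r ∣ Φ x
      r∣ = divides p e
      p∣ : p ∣ Φ x
      p∣ = divides r (trans e (*-comm p r))
      p≡1 = factor%3 pp p∣
      x<r = root<cofactor-bound e p≤r
      1<p : 1 < p
      1<p = nonTrivial⇒n>1 p ⦃ prime⇒nonTrivial pp ⦄
      1<r : 1 < r
      1<r = nonTrivial⇒n>1 r ⦃ prime⇒nonTrivial pr ⦄
      -- Here r is both (Φ z) / 3 and a cofactor of Φ x, so that x + z + 1 = r;
      -- this determines p = x + 3 - z, which is then too large to come from an image.
      free-cofactor : ∀ {z} → z ∈ S → AImage r z → kind p ≡ free
      free-cofactor {z} z∈ (z≡1 , ez) = by-view (kind-view p≡1)
        where
        5≤z = odd-prime≡1⇒≥5 (S-prime z∈) (S-odd z∈) z≡1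
        z<r = Φ≡3r⇒<r (≤-trans (s≤s (s≤s (s≤s z≤n))) 5≤z) ez
        x+z+1≡r : x + z + 1 ≡ r
        x+z+1≡r with <-cmp x z
        ... | tri< x<z _ _ = root-difference pr x<z z<r r∣ (divides 3 ez)
        ... | tri≈ _ refl _ with () ← trans (sym x≡2) z≡1
        ... | tri> _ _ z<x = trans (cong (_+ 1) (+-comm x z)) (root-difference pr z<x x<r (divides 3 ez) r∣)
        p+z≡x+3 : p + z ≡ x + 3
        p+z≡x+3 = third-image-cofactor {y = x} ⦃ prime⇒nonZero pr ⦄ x+z+1≡r ez e
        by-view : ∀ {k} → KindView p k → k ≡ free
        by-view (isFree _ _) = refl
        by-view (isU i) with a , a∈ , (_ , refl) ← find i = ⊥-elim (third-image-cofactor-large {y = x} 5≤z x+z+1≡r ez p+z≡x+3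
          (root-of-Φ-value (S-prime a∈) (S-odd a∈) px ox pp
            (Φ-cancel-< (subst (p <_) (sym e) (m<m*n p r ⦃ prime⇒nonZero pp ⦄ 1<r))) p∣))
        by-view (isV _ i) with z′ , z′∈ , (_ , e′) ← find i = ⊥-elim
          (third-image-cofactor-not-third-image 5≤z (S-odd z∈) (S-odd z′∈) x+z+1≡r ez p+z≡x+3 e′)
      by-kind : ∀ k → KindView r k → bonusB k ≤ ∑ (bonus x) P → dB ≤ w p + weight k + ∑ (bonus x) P
      by-kind U (isU i) _ with a , a∈ , (_ , refl) ← find i =
        ⊥-elim (no-Φ-value-factor (S-prime a∈) (S-odd a∈) px ox pr 1<p (≤-trans p≤r (m≤n*m r 3)) e)
      by-kind V (isV _ i) h with z , z∈ , im ← find i =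
        ≤-trans B₂′ (+-mono-≤ (+-monoˡ-≤ v (≤-reflexive (cong weight (sym (free-cofactor z∈ im))))) h)
      by-kind free _ h = ≤-trans B₂ (+-mono-≤ (+-monoˡ-≤ z (u≤w p p≡1)) h)

    charge₃ : ∀ {p q r} → Prime p → Prime q → Prime r → Φ x ≡ p * (q * r) → dB ≤ w p + (w q + w r)
    charge₃ {p} {q} {r} pp pq pr e = cases (U-or-v≤w p p≡1) (U-or-v≤w q q≡1) (U-or-v≤w r r≡1)
      where
      p≡1 = factor%3 pp (divides (q * r) (trans e (*-comm p (q * r))))
      q≡1 = factor%3 pq (subst (q ∣_) (sym e) (∣n⇒∣m*n p (m∣m*n r)))
      r≡1 = factor%3 pr (subst (r ∣_) (sym e) (∣n⇒∣m*n p (n∣m*n q)))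
      Image : ℕ → Set
      Image r = (∃ λ a → a ∈ S × BImage r a) ⊎ v ≤ w r
      cases : Image p → Image q → Image r → dB ≤ w p + (w q + w r)
      cases (inj₂ h) _ _ = ≤-trans B₃ (+-mono-≤ h (+-mono-≤ (u≤w q q≡1) (u≤w r r≡1)))
      cases _ (inj₂ h) _ = ≤-trans B₃ (≤-trans (≤-reflexive (B₃-middle u v)) (+-mono-≤ (u≤w p p≡1) (+-mono-≤ h (u≤w r r≡1))))
      cases _ _ (inj₂ h) = ≤-trans B₃ (≤-trans (≤-reflexive (B₃-last u v)) (+-mono-≤ (u≤w p p≡1) (+-mono-≤ (u≤w q q≡1) h)))
      cases (inj₁ (a , a∈ , a≡2 , refl)) (inj₁ (b , b∈ , b≡2 , refl)) (inj₁ (c , c∈ , c≡2 , refl)) =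
        ⊥-elim (no-triple-Φ-value {y = x} {i = a / 3} {j = b / 3} {k = c / 3} {l = x / 3}
          (S-prime a∈) (S-prime b∈) (S-prime c∈) pp pq pr
          (odd-prime≥3 (S-prime a∈) (S-odd a∈)) (odd-prime≥3 (S-prime b∈) (S-odd b∈)) (odd-prime≥3 (S-prime c∈) (S-odd c∈))
          (%3⇒ a 2 a≡2) (%3⇒ b 2 b≡2) (%3⇒ c 2 c≡2) (%3⇒ x 2 x≡2) e)

    charge : ∀ ps → All Prime ps → product ps ≡ Φ x → dB ≤ ∑ w ps + ∑ (bonus x) P
    charge [] _ e = ⊥-elim (<⇒≢ (≤-trans (s≤s (<⇒≤ (nonTrivial⇒n>1 x ⦃ prime⇒nonTrivial px ⦄))) (x<Φx x)) e)
    charge (r ∷ []) (pr ∷ []) e = subst (λ m → dB ≤ m + ∑ (bonus x) P) (sym (+-identityʳ (w r)))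
      (charge₁ pr (trans (sym e) (*-identityʳ r)))
    charge (p ∷ r ∷ []) (pp ∷ pr ∷ []) e with ≤-total p r
    ... | inj₁ p≤r = subst (λ m → dB ≤ m + ∑ (bonus x) P) (cong (w p +_) (sym (+-identityʳ (w r))))
      (charge₂ pp pr p≤r (trans (sym e) (cong (p *_) (*-identityʳ r))))
    ... | inj₂ r≤p = subst (λ m → dB ≤ m + ∑ (bonus x) P) (trans (+-comm (w r) (w p)) (cong (w p +_) (sym (+-identityʳ (w r)))))
      (charge₂ pr pp r≤p (trans (sym e) (trans (cong (p *_) (*-identityʳ r)) (*-comm p r))))
    charge (p ∷ q ∷ r ∷ []) (pp ∷ pq ∷ pr ∷ []) e = ≤-trans
      (subst (λ m → dB ≤ w p + (w q + m)) (sym (+-identityʳ (w r)))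
        (charge₃ pp pq pr (trans (sym e) (cong (λ m → p * (q * m)) (*-identityʳ r))))) (m≤m+n _ _)
    charge ps@(p ∷ q ∷ r ∷ s ∷ rs) (pp ∷ pq ∷ pr ∷ pr′ ∷ _) e = ≤-trans B₄ (≤-trans
      (+-mono-≤ (at (here refl) pp) (+-mono-≤ (at (there (here refl)) pq) (+-mono-≤ (at (there (there (here refl))) pr)
        (≤-trans (at (there (there (there (here refl)))) pr′) (m≤m+n _ (∑ w rs)))))) (m≤m+n _ _))
      where
      at : ∀ {r} → r ∈ ps → Prime r → u ≤ w r
      at {r} r∈ pr = u≤w r (factor%3 pr (subst (r ∣_) e (∈⇒∣product r∈)))

  module A-element {x} (x∈ : x ∈ S) (x≡1 : x % 3 ≡ 1) where
    private
      px = S-prime x∈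
      ox = S-odd x∈
      k = x / 3

    -- Φ x / 3, in a form showing that it is 1 modulo 3: the factor 3 occurs in `Φ x` exactly once.
    M : ℕ
    M = 1 + (k + k * k) * 3

    Φx≡3M : Φ x ≡ 3 * M
    Φx≡3M = trans (cong Φ (%3⇒ x 1 x≡1)) (Φ[1+k*3] k)

    ∣M⇒∣Φ : ∀ {r} → r ∣ M → r ∣ Φ x
    ∣M⇒∣Φ {r} r∣ = subst (r ∣_) (sym Φx≡3M) (∣n⇒∣m*n 3 r∣)

    factor%3 : ∀ {r} → Prime r → r ∣ M → r % 3 ≡ 1
    factor%3 pr r∣ = factor≡1 x (k + k * k) pr (∣M⇒∣Φ r∣) r∣

    charge₁ : ∀ {r} → Prime r → M ≡ r → dA ≤ t + w r + ∑ (bonus x) P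
    charge₁ {r} pr e = by-kind (kind r) (kind-view (factor%3 pr r∣)) (A-bonus≤ {x} (factor∈P x∈ pr (∣M⇒∣Φ r∣)) x≡1 Φx≡3r)
      where
      r∣ : r ∣ M
      r∣ = ∣-reflexive (sym e)
      Φx≡3r : Φ x ≡ 3 * r
      Φx≡3r = trans Φx≡3M (cong (3 *_) e)
      by-kind : ∀ k → KindView r k → bonusA k ≤ ∑ (bonus x) P → dA ≤ t + weight k + ∑ (bonus x) P
      by-kind U (isU i) _ with a , a∈ , (_ , refl) ← find i =
        ⊥-elim (no-Φ-value-factor (S-prime a∈) (S-odd a∈) px ox pr (s≤s (s≤s z≤n)) (m≤m*n 3 r ⦃ prime⇒nonZero pr ⦄) Φx≡3r)
      by-kind V _ h = ≤-trans A₁ (+-monoʳ-≤ (t + v) h)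
      by-kind free (isFree _ ¬i) _ = ⊥-elim (¬i (lose x∈ (x≡1 , Φx≡3r)))

    charge₂ : ∀ {p r} → Prime p → Prime r → p ≤ r → M ≡ p * r → dA ≤ t + (w p + w r)
    charge₂ {p} {r} pp pr p≤r e = cases (U-or-v≤w r (factor%3 pr (divides p e)))
      where
      p≡1 = factor%3 pp (divides r (trans e (*-comm p r)))
      cases : (∃ λ a → a ∈ S × BImage r a) ⊎ v ≤ w r → dA ≤ t + (w p + w r)
      cases (inj₂ h) = ≤-trans A₂ (+-monoʳ-≤ t (+-mono-≤ (u≤w p p≡1) h))
      cases (inj₁ (a , a∈ , _ , refl)) = ⊥-elim (no-Φ-value-factor (S-prime a∈) (S-odd a∈) px ox pr
        (≤-trans (s≤s (s≤s z≤n)) (m≤m*n 3 p ⦃ prime⇒nonZero pp ⦄)) (*-monoʳ-≤ 3 p≤r)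
        (trans Φx≡3M (trans (cong (3 *_) e) (sym (*-assoc 3 p r)))))

    charge : ∀ ps → All Prime ps → product ps ≡ M → dA ≤ t + ∑ w ps + ∑ (bonus x) P
    charge [] _ e = ⊥-elim (<⇒≢ (≤-<-trans (odd-prime≥3 px ox) (x<Φx x)) (sym (trans Φx≡3M (cong (3 *_) (sym e)))))
    charge (r ∷ []) (pr ∷ []) e = subst (λ m → dA ≤ t + m + ∑ (bonus x) P) (sym (+-identityʳ (w r)))
      (charge₁ pr (trans (sym e) (*-identityʳ r)))
    charge (p ∷ r ∷ []) (pp ∷ pr ∷ []) e = ≤-trans (ordered (≤-total p r)) (m≤m+n _ _)
      where
      M≡pr : M ≡ p * r
      M≡pr = trans (sym e) (cong (p *_) (*-identityʳ r))
      ordered : p ≤ r ⊎ r ≤ p → dA ≤ t + (w p + (w r + 0))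
      ordered (inj₁ p≤r) = subst (λ m → dA ≤ t + (w p + m)) (sym (+-identityʳ (w r))) (charge₂ pp pr p≤r M≡pr)
      ordered (inj₂ r≤p) = subst (λ m → dA ≤ t + m) (trans (+-comm (w r) (w p)) (cong (w p +_) (sym (+-identityʳ (w r)))))
        (charge₂ pr pp r≤p (trans M≡pr (*-comm p r)))
    charge ps@(p ∷ q ∷ r ∷ rs) (pp ∷ pq ∷ pr ∷ _) e = ≤-trans A₃ (≤-trans
      (+-monoʳ-≤ t (+-mono-≤ (at (here refl) pp) (+-mono-≤ (at (there (here refl)) pq)
        (≤-trans (at (there (there (here refl))) pr) (m≤m+n _ (∑ w rs)))))) (m≤m+n _ _))
      where
      at : ∀ {r} → r ∈ ps → Prime r → u ≤ w r
      at {r} r∈ pr = u≤w r (factor%3 pr (subst (r ∣_) e (∈⇒∣product r∈)))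

  -- The factors are kept as a list, to be concatenated over S: it is the joint product dividing N
  -- that limits repeated use of a prime.
  Charge : ℕ → Set
  Charge x = ∃ λ ps → All Prime ps × product ps ≡ Φ x × demand x ≤ ∑ w ps + ∑ (bonus x) P

  charge : ∀ {x} → x ∈ S → Charge x
  charge {x} x∈ with %3-cases x
  ... | inj₁ e = factors , factorsPrime , sym isFactorisation ,
      subst (λ m → residue-demand m ≤ ∑ w factors + ∑ (bonus x) P) (sym e) z≤n
    where open PrimeFactorisation (factorise (Φ x) ⦃ Φ-nonZero x ⦄)
  ... | inj₂ (inj₁ e) = 3 ∷ factors , prime[3] ∷ factorsPrime , trans (cong (3 *_) (sym isFactorisation)) (sym Φx≡3M) ,
      subst (λ m → residue-demand m ≤ t + ∑ w factors + ∑ (bonus x) P) (sym e) (A-element.charge x∈ e factors factorsPrime (sym isFactorisation))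
    where
    open A-element x∈ e using (M; Φx≡3M)
    open PrimeFactorisation (factorise M)
  ... | inj₂ (inj₂ e) = factors , factorsPrime , sym isFactorisation ,
      subst (λ m → residue-demand m ≤ ∑ w factors + ∑ (bonus x) P) (sym e) (B-element.charge x∈ e factors factorsPrime (sym isFactorisation))
    where open PrimeFactorisation (factorise (Φ x) ⦃ Φ-nonZero x ⦄)

  charges : ∀ xs → (∀ {x} → x ∈ xs → x ∈ S) →
            ∃ λ rs → All Prime rs × product rs ≡ product (map Φ xs) ×
                     ∑ demand xs ≤ ∑ w rs + ∑ (λ x → ∑ (bonus x) P) xs
  charges [] _ = [] , [] , refl , z≤n
  charges (x ∷ xs) h with ps , pps , eps , d ← charge (h (here refl)) | rs , prs , ers , ds ← charges xs (h ∘ there) =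
    ps ++ rs , All.++⁺ pps prs , trans (product-++ ps rs) (cong₂ _*_ eps ers) , (begin
      demand x + ∑ demand xs
        ≤⟨ +-mono-≤ d ds ⟩
      ∑ w ps + ∑ (bonus x) P + (∑ w rs + ∑ (λ x → ∑ (bonus x) P) xs)
        ≡⟨ interchange (∑ w ps) (∑ (bonus x) P) (∑ w rs) (∑ (λ x → ∑ (bonus x) P) xs) ⟩
      ∑ w ps + ∑ w rs + (∑ (bonus x) P + ∑ (λ x → ∑ (bonus x) P) xs)
        ≡⟨ cong (_+ (∑ (bonus x) P + ∑ (λ x → ∑ (bonus x) P) xs)) (∑-++ w ps rs) ⟨
      ∑ w (ps ++ rs) + (∑ (bonus x) P + ∑ (λ x → ∑ (bonus x) P) xs) ∎)
    where open ≤-Reasoning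

  -- The most that p can pay: its weight in each of its slots, and each bonus once.
  supply : ℕ → ℕ
  supply p = valuation p N * w p + income p

  ∑-demand≤∑-supply : ∑ demand S ≤ ∑ supply P
  ∑-demand≤∑-supply with rs , prs , ers , ds ← charges S (λ x∈ → x∈) = begin
      ∑ demand S
        ≤⟨ ds ⟩
      ∑ w rs + ∑ (λ x → ∑ (bonus x) P) S
        ≤⟨ +-mono-≤ (≤-trans (∑≤∑-count w rs (λ r∈ → ∈-primeDivisors⁺ (All.lookup prs r∈) (∣-trans (∈⇒∣product r∈) ∏∣N)))
                      (∑-mono-≤ P (λ {p} p∈ → *-monoˡ-≤ (w p) (count≤valuation oN perfect rs (proj₁ (∈-primeDivisors⁻ {n = N} p∈)) ∏∣N))))
                    (≤-trans (≤-reflexive (∑-swap bonus S P)) (∑-mono-≤ P ∑-bonus≤income)) ⟩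
      ∑ (λ p → valuation p N * w p) P + ∑ income P
        ≡⟨ ∑-+ (λ p → valuation p N * w p) income P ⟨
      ∑ supply P ∎
    where
    open ≤-Reasoning
    ∏∣N : product rs ∣ N
    ∏∣N = subst (_∣ N) (sym ers) (∏Φ∣N oN perfect S S-unique (λ x∈ → S-prime x∈ , S-valuation x∈))

  -- Weak duality: in the sum of the hypothesis over all primes of N, the demands on the right are
  -- covered by the supplies on the left.
  accounting : ∀ κ ρ ε → (∀ {p} → p ∈ P → κ + supply p ≤ ρ * valuation p N + when (valuation p N ≟ 2) (demand p) + ε p) →
               κ * ω N ≤ ρ * Ω N + ∑ ε P
  accounting κ ρ ε h = +-cancelʳ-≤ (∑ supply P) _ _ (begin
    κ * ω N + ∑ supply P
      ≡⟨ cong (_+ ∑ supply P) (∑-const κ P) ⟨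
    ∑ (λ _ → κ) P + ∑ supply P
      ≡⟨ ∑-+ (λ _ → κ) supply P ⟨
    ∑ (λ p → κ + supply p) P
      ≤⟨ ∑-mono-≤ P h ⟩
    ∑ (λ p → ρ * valuation p N + when (valuation p N ≟ 2) (demand p) + ε p) P
      ≡⟨ ∑-+ (λ p → ρ * valuation p N + when (valuation p N ≟ 2) (demand p)) ε P ⟩
    ∑ (λ p → ρ * valuation p N + when (valuation p N ≟ 2) (demand p)) P + ∑ ε P
      ≡⟨ cong (_+ ∑ ε P) (∑-+ (λ p → ρ * valuation p N) (λ p → when (valuation p N ≟ 2) (demand p)) P) ⟩
    ∑ (λ p → ρ * valuation p N) P + ∑ (λ p → when (valuation p N ≟ 2) (demand p)) P + ∑ ε P
      ≡⟨ cong₂ (λ a b → a + b + ∑ ε P) (∑-* ρ (λ p → valuation p N) P) (sym (∑-filter (λ p → valuation p N ≟ 2) demand P)) ⟩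
    ρ * Ω N + ∑ demand S + ∑ ε P
      ≤⟨ +-monoˡ-≤ (∑ ε P) (+-monoʳ-≤ (ρ * Ω N) ∑-demand≤∑-supply) ⟩
    ρ * Ω N + ∑ supply P + ∑ ε P
      ≡⟨ trans (+-assoc (ρ * Ω N) (∑ supply P) (∑ ε P)) (trans (cong (ρ * Ω N +_) (+-comm (∑ supply P) (∑ ε P))) (sym (+-assoc (ρ * Ω N) (∑ ε P) (∑ supply P)))) ⟩
    ρ * Ω N + ∑ ε P + ∑ supply P ∎)
    where open ≤-Reasoning

-- From the charging scheme to the two bounds

κ+[3*a+i] : ∀ κ a i → κ + (3 * a + i) ≡ κ + (a + i) + 2 * a
κ+[3*a+i] = solve-∀

ρ+η+2*ρ : ∀ ρ η → ρ + η + 2 * ρ ≡ ρ * 3 + 0 + η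
ρ+η+2*ρ = solve-∀

132+[f*50+0] : ∀ f → 132 + (f * 50 + 0) ≡ 50 * f + 132
132+[f*50+0] = solve-∀

κ+[x+i] : ∀ κ x i → κ + (x + i) ≡ x + (κ + i)
κ+[x+i] = solve-∀

-- One inequality for all exponents f: f = 1 and f = 3 draw on the allowance η of the
-- odd exponent, f = 2 on the demand d, and f ≥ 4 on the surplus δ per unit of exponent.
exponent-bound : ∀ κ a δ i η d f → κ + (a + i) ≤ a + δ + η → (f ≡ 2 → κ + (2 * a + i) ≤ (a + δ) * 2 + d) →
  κ + i ≤ 4 * δ → 0 < f → κ + (f * a + i) ≤ (a + δ) * f + when (f ≟ 2) d + when (odd? f) η
exponent-bound κ a δ i η d 1 h₁ _ _ _ = subst₂ _≤_
  (cong (λ m → κ + (m + i)) (sym (+-identityʳ a)))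
  (cong (_+ η) (trans (sym (*-identityʳ (a + δ))) (sym (+-identityʳ ((a + δ) * 1))))) h₁
exponent-bound κ a δ i η d 2 _ h₂ _ _ = ≤-trans (h₂ refl) (m≤m+n ((a + δ) * 2 + d) 0)
exponent-bound κ a δ i η d 3 h₁ _ _ _ = begin
  κ + (3 * a + i)              ≡⟨ κ+[3*a+i] κ a i ⟩
  κ + (a + i) + 2 * a          ≤⟨ +-mono-≤ h₁ (*-monoʳ-≤ 2 (m≤m+n a δ)) ⟩
  a + δ + η + 2 * (a + δ)      ≡⟨ ρ+η+2*ρ (a + δ) η ⟩
  (a + δ) * 3 + 0 + η          ∎
  where open ≤-Reasoning
exponent-bound κ a δ i η d f@(suc (suc (suc (suc g)))) _ _ h₄ _ = begin
  κ + (f * a + i)    ≡⟨ κ+[x+i] κ (f * a) i ⟩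
  f * a + (κ + i)    ≤⟨ +-monoʳ-≤ (f * a) (≤-trans h₄ (*-monoˡ-≤ δ {4} {f} (s≤s (s≤s (s≤s (s≤s z≤n)))))) ⟩
  f * a + f * δ      ≡⟨ *-distribˡ-+ f a δ ⟨
  f * (a + δ)        ≡⟨ *-comm f (a + δ) ⟩
  (a + δ) * f        ≤⟨ ≤-trans (m≤m+n _ 0) (m≤m+n _ _) ⟩
  (a + δ) * f + 0 + when (odd? f) η ∎
  where open ≤-Reasoning

prime-multiple-of-3 : ∀ {p} → Prime p → 3 ∣ p → p ≡ 3
prime-multiple-of-3 pp 3∣p with prime⇒irreducible pp 3∣p
... | inj₁ ()
... | inj₂ 3≡p = sym 3≡p

-- Feasible dual solutions; weights₂ is optimal and scaled by 2 to be integral.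
weights₁ weights₂ : Weights
weights₁ = record
  { u = 23 ; v = 30 ; z = 30 ; t = 0 ; b = 53 ; l = 23 ; l′ = 23 ; c = 0 ; dB = 76 ; dA = 0
  ; u≤v = from-yes (23 ≤? 30) ; v≤z = ≤-refl
  ; B₁ = ≤-refl ; B₂ = ≤-refl ; B₂′ = from-yes (76 ≤? 83) ; B₃ = ≤-refl ; B₄ = from-yes (76 ≤? 92)
  ; A₁ = z≤n ; A₂ = z≤n ; A₃ = z≤n }
weights₂ = record
  { u = 9 ; v = 14 ; z = 15 ; t = 50 ; b = 23 ; l = 8 ; l′ = 3 ; c = 9 ; dB = 32 ; dA = 73
  ; u≤v = from-yes (9 ≤? 14) ; v≤z = from-yes (14 ≤? 15)
  ; B₁ = ≤-refl ; B₂ = ≤-refl ; B₂′ = ≤-refl ; B₃ = ≤-refl ; B₄ = from-yes (32 ≤? 36)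
  ; A₁ = ≤-refl ; A₂ = ≤-refl ; A₃ = from-yes (73 ≤? 77) }

3∣Φ : ∀ {p} → p % 3 ≡ 1 → 3 ∣ Φ p
3∣Φ {p} e = subst (3 ∣_) (sym (trans (cong Φ (%3⇒ p 1 e)) (Φ[1+k*3] (p / 3)))) (m∣m*n {3} (1 + (p / 3 + p / 3 * (p / 3)) * 3))

module _ {N} (oN : Odd N) (perfect : Perfect N) where
  coprime-to-3-bound : ¬ (3 ∣ N) → 302 * ω N ≤ 113 * Ω N + 286
  coprime-to-3-bound 3∤N = ≤-trans (accounting 302 113 (λ p → when (odd? (valuation p N)) 286) pointwise)
      (+-monoʳ-≤ (113 * Ω N) (∑-odd-valuations oN perfect 286))
    where
    open Charging oN perfect weights₁
    Goal : ℕ → Kind → ℕ → Set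
    Goal f k d = 302 + (f * weight k + (bonusB k + bonusA k)) ≤ 113 * f + when (f ≟ 2) d + when (odd? f) 286
    goal : ∀ {p k} f → p ∈ P → p % 3 ≡ 1 → valuation p N ≡ f → 0 < f → KindView p k → Goal f k 0
    goal {p} f p∈ e v 0<f = λ
      { (isU _)      → exponent-bound 302 23 90 53 286 0 f (from-yes (378 ≤? 399)) f≢2 (from-yes (355 ≤? 360)) 0<f
      ; (isV _ _)    → exponent-bound 302 30 83 23 286 0 f (from-yes (355 ≤? 399)) f≢2 (from-yes (325 ≤? 332)) 0<f
      ; (isFree _ _) → exponent-bound 302 30 83 23 286 0 f (from-yes (355 ≤? 399)) f≢2 (from-yes (325 ≤? 332)) 0<f }
      where
      -- Exponent 2 would put p into S, and then 3 ∣ Φ p ∣ N.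
      f≢2 : ∀ {a} {A : Set a} → f ≡ 2 → A
      f≢2 refl = ⊥-elim (3∤N (∣-trans (3∣Φ {p} e) (Φ∣N (∈-filter⁺ (λ p → valuation p N ≟ 2) p∈ v))))
    pointwise : ∀ {p} → p ∈ P → 302 + supply p ≤ 113 * valuation p N + when (valuation p N ≟ 2) (demand p) + when (odd? (valuation p N)) 286
    pointwise {p} p∈ with %3-cases p
    ... | inj₁ e = ⊥-elim (3∤N (∣-trans (divides (p / 3) (%3⇒ p 0 e)) (proj₂ (∈-primeDivisors⁻ {n = N} p∈))))
    ... | inj₂ (inj₁ e) = subst (Goal (valuation p N) (kind p)) (cong residue-demand (sym e))
            (goal (valuation p N) p∈ e refl (valuation>0 ⦃ odd⇒nonZero oN ⦄ p∈) (kind-view {p} e))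
    ... | inj₂ (inj₂ e) = subst₂ (Goal (valuation p N))
            (cong (λ m → residue-kind m (image-kind (B-image? p) (A-image? p))) (sym e)) (cong residue-demand (sym e))
            (exponent-bound 302 0 113 0 286 76 (valuation p N) (from-yes (302 ≤? 399)) (λ _ → from-yes (302 ≤? 302)) (from-yes (302 ≤? 452)) (valuation>0 ⦃ odd⇒nonZero oN ⦄ p∈))

  general-bound : 66 * ω N ≤ 25 * Ω N + 125
  general-bound = *-cancelˡ-≤ 2 (begin
      2 * (66 * ω N)        ≡⟨ *-assoc 2 66 (ω N) ⟨
      132 * ω N             ≤⟨ accounting 132 50 ε pointwise ⟩
      50 * Ω N + ∑ ε P      ≤⟨ +-monoʳ-≤ (50 * Ω N) ∑ε≤250 ⟩
      50 * Ω N + 250        ≡⟨ cong (_+ 250) (*-assoc 2 25 (Ω N)) ⟩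
      2 * (25 * Ω N) + 250  ≡⟨ *-distribˡ-+ 2 (25 * Ω N) 125 ⟨
      2 * (25 * Ω N + 125)  ∎)
    where
    open ≤-Reasoning
    open Charging oN perfect weights₂
    ε : ℕ → ℕ
    -- The exponent of 3 is unbounded, so its weight `t` can be at most ρ = 50. With equality
    -- nothing is left for its share κ = 132, which goes into the constant: 250 = 132 + 118.
    ε p = when (odd? (valuation p N)) 118 + when (p ≟ 3) 132
    ∑ε≤250 : ∑ ε P ≤ 250
    ∑ε≤250 = ≤-trans (≤-reflexive (∑-+ (λ p → when (odd? (valuation p N)) 118) (λ p → when (p ≟ 3) 132) P))
      (+-mono-≤ (∑-odd-valuations oN perfect 118)
        (∑-at-most-one (_≟ 3) 132 (primeDivisors-unique N) (λ _ _ x≡3 y≡3 → trans x≡3 (sym y≡3))))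
    Goal : ℕ → Kind → ℕ → Set
    Goal f k d = 132 + (f * weight k + (bonusB k + bonusA k)) ≤ 50 * f + when (f ≟ 2) d + when (odd? f) 118
    goal : ∀ {p k} f → 0 < f → KindView p k → Goal f k 73
    -- Tight cases: kind U at exponent 2, where 173 = 100 + 73, and kinds V and free at exponent 4,
    -- where 144 = 4·36 and 140 = 4·35.
    goal f 0<f (isU _)      = exponent-bound 132 9 41 23 118 73 f (from-yes (164 ≤? 168)) (λ _ → from-yes (173 ≤? 173)) (from-yes (155 ≤? 164)) 0<f
    goal f 0<f (isV _ _)    = exponent-bound 132 14 36 12 118 73 f (from-yes (158 ≤? 168)) (λ _ → from-yes (172 ≤? 173)) (from-yes (144 ≤? 144)) 0<f
    goal f 0<f (isFree _ _) = exponent-bound 132 15 35 8 118 73 f (from-yes (155 ≤? 168)) (λ _ → from-yes (170 ≤? 173)) (from-yes (140 ≤? 140)) 0<f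
    weaken : ∀ {f k d} p → Goal f k d → 132 + (f * weight k + (bonusB k + bonusA k)) ≤ 50 * f + when (f ≟ 2) d + (when (odd? f) 118 + when (p ≟ 3) 132)
    weaken {f} {k} {d} p h = ≤-trans h (+-monoʳ-≤ (50 * f + when (f ≟ 2) d) (m≤m+n (when (odd? f) 118) (when (p ≟ 3) 132)))
    pointwise : ∀ {p} → p ∈ P → 132 + supply p ≤ 50 * valuation p N + when (valuation p N ≟ 2) (demand p) + ε p
    pointwise {p} p∈ with %3-cases p
    ... | inj₁ e = three-case (prime-multiple-of-3 (proj₁ (∈-primeDivisors⁻ {n = N} p∈)) (divides (p / 3) (%3⇒ p 0 e)))
      where
      three-case : p ≡ 3 → 132 + supply p ≤ 50 * valuation p N + when (valuation p N ≟ 2) (demand p) + ε p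
      three-case refl = ≤-trans (≤-reflexive (132+[f*50+0] (valuation 3 N)))
        (+-mono-≤ (m≤m+n (50 * valuation 3 N) _) (m≤n+m 132 (when (odd? (valuation 3 N)) 118)))
    ... | inj₂ (inj₁ e) = weaken {valuation p N} {kind p} {demand p} p (subst (Goal (valuation p N) (kind p)) (cong residue-demand (sym e))
            (goal {p} (valuation p N) (valuation>0 ⦃ odd⇒nonZero oN ⦄ p∈) (kind-view {p} e)))
    ... | inj₂ (inj₂ e) = weaken {valuation p N} {kind p} {demand p} p (subst₂ (Goal (valuation p N))
            (cong (λ m → residue-kind m (image-kind (B-image? p) (A-image? p))) (sym e)) (cong residue-demand (sym e))
            (exponent-bound 132 0 50 0 118 32 (valuation p N) (from-yes (132 ≤? 168)) (λ _ → from-yes (132 ≤? 132)) (from-yes (132 ≤? 200)) (valuation>0 ⦃ odd⇒nonZero oN ⦄ p∈)))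

theorem2 : (N : ℕ) → Odd N → Perfect N →
    ((¬ (3 ∣ N)) → 302 * ω N ≤ 113 * Ω N + 286) ×
    ((3 ∣ N) → 66 * ω N ≤ 25 * Ω N + 125)
theorem2 N oN perfect = coprime-to-3-bound oN perfect , λ _ → general-bound oN perfect
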